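{- Exactly $\gcd(3,q-1)$ of the $\mathbb{F}_q$-planes in $\mathrm{Orb}(\mathsf S_T)$ are fixed setwise by $\phi$, namely the sets $\pi_\lambda=\{(x,x^q,\lambda x^{q^2}):x\in\mathbb{F}_{q^3}^*\}$ with $\lambda\in\mathbb{F}_q$, $\lambda^3=1$. Further, $\pi_1=\mathcal P_{2,q}$, and if $\gcd(3,q-1)=3$ then the other two $\mathbb{F}_q$-planes fixed setwise by $\phi$ have only Type III points and only Type III lines.
   Context: Let $q$ be a prime power, $\mathbb{F}_{q^3}^*=\mathbb{F}_{q^3}\setminus\{0\}$. Points of $\mathrm{PG}(2,q^3)$ have coordinates $(x,y,z)$, lines $[a,b,c]$. An $\mathbb{F}_q$-plane is a subplane of order $q$; its lines are those meeting it in $q+1$ points. Let $\phi$ be the collineation $(x,y,z)\mapsto(z^q,x^q,y^q)$ (on lines $[d,e,f]\mapsto[f^q,d^q,e^q]$); its fixed points form $\mathcal P_{2,q}=\{(x,x^q,x^{q^2}):x\in\mathbb{F}_{q^3}^*\}$. A point has Type I, II, III according as its $\phi$-orbit is one point, three collinear points, three non-collinear points; a line has Type I, II, III according as its $\phi$-orbit is one line, three concurrent lines, three non-concurrent lines. Let $\psi_t\colon(x,y,z)\mapsto(tx,t^qy,t^{q^2}z)$, $\mathsf S_T=\{\psi_t:t\in\mathbb{F}_{q^3}^*\}$, and $\mathrm{Orb}(\mathsf S_T)$ the set of point orbits of $\mathsf S_T$. -}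

module Defs where

open import Level using (0ℓ)
open import Data.Nat using (ℕ; zero; suc)
open import Data.Product using (Σ; ∃; _×_; _,_)
open import Data.List using (List; length)
open import Data.List.Relation.Unary.All using (All)
open import Data.List.Relation.Unary.Any using (Any)
open import Data.List.Relation.Unary.AllPairs using (AllPairs)
open import Data.List.Relation.Unary.Unique.Propositional using (Unique)
open import Data.List.Membership.Propositional using (_∈_)
open import Relation.Nullary using (¬_)
open import Relation.Binary.PropositionalEquality using (_≡_)
open import Relation.Binary.Definitions using (DecidableEquality)
open import Algebra.Structures using (IsCommutativeRing)

record FiniteField : Set₁ where
  infixl 6 _+_
  infixl 7 _*_
  field
    Carrier           : Set
    _+_ _*_           : Carrier → Carrier → Carrier
    -_                : Carrier → Carrier
    0# 1#             : Carrier
    isCommutativeRing : IsCommutativeRing _≡_ _+_ _*_ -_ 0# 1#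
    0≢1               : ¬ (0# ≡ 1#)
    inverse           : (x : Carrier) → ¬ (x ≡ 0#) → Σ Carrier (λ y → x * y ≡ 1#)
    _≟_               : DecidableEquality Carrier
    elements          : List Carrier
    elements-unique   : Unique elements
    elements-complete : (x : Carrier) → x ∈ elements

  card : ℕ
  card = length elements

-- Geometry of PG(2, F) with F = F_{q^3}; q is the exponent of the Frobenius x ↦ x^q.
module PG (F : FiniteField) (q : ℕ) where
  open FiniteField F

  pow : Carrier → ℕ → Carrier
  pow x zero    = 1#
  pow x (suc n) = x * pow x n

  fr : Carrier → Carrier
  fr x = pow x q

  InFq : Carrier → Set
  InFq x = fr x ≡ x

  -- homogeneous coordinate triples (used both for points and lines)
  Tri : Set
  Tri = Carrier × Carrier × Carrier

  NZ : Tri → Set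
  NZ (x , y , z) = ¬ ((x ≡ 0#) × (y ≡ 0#) × (z ≡ 0#))

  scale : Carrier → Tri → Tri
  scale c (x , y , z) = (c * x , c * y , c * z)

  _∼_ : Tri → Tri → Set
  r ∼ s = Σ Carrier (λ c → ¬ (c ≡ 0#) × r ≡ scale c s)

  On : Tri → Tri → Set
  On (a , b , c) (x , y , z) = a * x + b * y + c * z ≡ 0#

  PointSet : Set₁
  PointSet = Tri → Set

  SameSet : PointSet → PointSet → Set
  SameSet S T = (r : Tri) → (S r → T r) × (T r → S r)

  MeetsIn : ℕ → PointSet → Tri → Set
  MeetsIn n S ℓ =
    Σ (List Tri) (λ xs →
      (length xs ≡ n)
      × All (λ r → NZ r × S r × On ℓ r) xs
      × AllPairs (λ r s → ¬ (r ∼ s)) xs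
      × ((r : Tri) → NZ r → S r → On ℓ r → Any (λ s → r ∼ s) xs))

  SLine : PointSet → Tri → Set
  SLine S ℓ = NZ ℓ × MeetsIn (suc q) S ℓ

  Collinear : Tri → Tri → Tri → Set
  Collinear a b c = Σ Tri (λ ℓ → NZ ℓ × On ℓ a × On ℓ b × On ℓ c)

  Concurrent : Tri → Tri → Tri → Set
  Concurrent l m n = Σ Tri (λ r → NZ r × On l r × On m r × On n r)

  -- S is an F_q-plane: a subplane of PG(2,q^3) of order q
  IsFqPlane : PointSet → Set
  IsFqPlane S =
    ((r s ℓ : Tri) → NZ r → NZ s → S r → S s → ¬ (r ∼ s) →
        NZ ℓ → On ℓ r → On ℓ s → MeetsIn (suc q) S ℓ)
    × ((ℓ m : Tri) → SLine S ℓ → SLine S m →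
        Σ Tri (λ r → NZ r × S r × On ℓ r × On m r))
    × Σ Tri (λ a → Σ Tri (λ b → Σ Tri (λ c → Σ Tri (λ d →
        (NZ a × NZ b × NZ c × NZ d)
        × (S a × S b × S c × S d)
        × ¬ Collinear a b c × ¬ Collinear a b d
        × ¬ Collinear a c d × ¬ Collinear b c d))))

  φ : Tri → Tri
  φ (x , y , z) = (fr z , fr x , fr y)

  φL : Tri → Tri
  φL (d , e , f) = (fr f , fr d , fr e)

  FixedByφ : PointSet → Set
  FixedByφ S = (r : Tri) → (S r → S (φ r)) × (S (φ r) → S r)

  TypeIIIPoint : Tri → Set
  TypeIIIPoint r = ¬ Collinear r (φ r) (φ (φ r))

  TypeIIILine : Tri → Set
  TypeIIILine ℓ = ¬ Concurrent ℓ (φL ℓ) (φL (φL ℓ))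

  P2q : PointSet
  P2q r = NZ r × (φ r ∼ r)

  ψ : Carrier → Tri → Tri
  ψ t (x , y , z) = (t * x , fr t * y , fr (fr t) * z)

  Orb : Tri → PointSet
  Orb p r = Σ Carrier (λ t → ¬ (t ≡ 0#) × r ∼ ψ t p)

  π : Carrier → PointSet
  π λ' r = Σ Carrier (λ x → ¬ (x ≡ 0#) × r ∼ (x , fr x , λ' * fr (fr x)))

  CubeRootFq : Carrier → Set
  CubeRootFq λ' = InFq λ' × (λ' * λ' * λ' ≡ 1#)

{-# OPTIONS --safe #-}
module Submission where

-- If φ fixes the orbit of p₀ then φ p₀ = s ψ_t p₀ for some scalar s and some t.  Comparing with
-- φ³ = 1 gives N(s) t³ = 1, so ω = t^(q−1) is a cube root of unity in F_q and N(s t^q) = 1; Hilbert's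
-- Theorem 90 then turns p₀ into a representative (u, u^q, λ u^(q²)) with λ = 1/ω.  Conversely, a line
-- meets π_λ in the zeros of the linearized polynomial a x + b x^q + c λ x^(q²), an F_q-space with at most
-- q² elements: as soon as it contains two independent elements it is their span, which gives q+1 points,
-- and two such spans in F_(q³) share a nonzero element because q⁴ > q³.  For λ ≠ 1 the three images of a
-- point (or line) of π_λ under φ form, up to scaling the coordinates, the circulant matrix of (1, 1, λ),
-- which is nonsingular since λ³ = 1 ≠ λ and 3 ≠ 0.

open import Defs
open import Algebra.Bundles using (CommutativeRing)
import Algebra.Properties.CommutativeSemiring.Binomial as Binomial
import Algebra.Properties.Monoid.Mult as MonoidMult
import Algebra.Properties.Monoid.Sum as MonoidSum
import Algebra.Properties.Ring as RingProperties
import Algebra.Properties.Semiring.Exp as SemiringExp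
import Algebra.Properties.Semiring.Mult as SemiringMult
import Algebra.Solver.Ring.NaturalCoefficients.Default as NatSolver
open import Data.Empty using (⊥-elim)
open import Data.Fin as Fin using (Fin; toℕ)
import Data.Fin.Properties as Fin
open import Data.List using (List; []; _++_; _∷_; cartesianProductWith; filter; foldr; length; map)
import Data.List.Membership.DecPropositional as DecMembership
open import Data.List.Membership.Propositional using (_∈_; _∉_; lose)
open import Data.List.Membership.Propositional.Properties
  using (∈-++⁺ʳ; ∈-++⁺ˡ; ∈-cartesianProductWith⁺; ∈-cartesianProductWith⁻; ∈-filter⁺; ∈-filter⁻;
    ∈-map⁺; ∈-map⁻; ∈-∃++)
open import Data.List.Properties using (length-++; length-map)
open import Data.List.Relation.Binary.Permutation.Propositional
  using (_↭_; prep; ↭-refl; ↭-trans; ↭⇒↭ₛ)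
open import Data.List.Relation.Binary.Permutation.Propositional.Properties
  using (++-identityʳ; shift; ↭-length; ∈-resp-↭)
import Data.List.Relation.Binary.Permutation.Setoid.Properties as PermutationSetoid
open import Data.List.Relation.Unary.All as All using (All; []; _∷_)
import Data.List.Relation.Unary.All.Properties as All
open import Data.List.Relation.Unary.AllPairs using (AllPairs; []; _∷_)
import Data.List.Relation.Unary.AllPairs.Properties as AllPairs
open import Data.List.Relation.Unary.Any as Any using (Any; any?; here; there)
import Data.List.Relation.Unary.Any.Properties as Any
open import Data.List.Relation.Unary.Unique.Propositional using (Unique)
import Data.List.Relation.Unary.Unique.Propositional.Properties as Unique
open import Data.Nat as ℕ using (_<_; _^_; _∸_; _≤_; _≥_; suc; s≤s; zero; z≤n; ℕ)
open import Data.Nat.Base using (_!)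
open import Data.Nat.Combinatorics using (_C_; k![n∸k]!∣n!; nCk≡n!/k![n-k]!; nCn≡1)
open import Data.Nat.DivMod using (m/n*n≡m)
open import Data.Nat.Divisibility using (_∣?_; _∣_; divides; m∣m*n; ∣-antisym; ∣-refl; ∣⇒≤)
open import Data.Nat.GCD using (gcd; gcd-greatest; gcd[m,n]∣m; gcd[m,n]∣n)
open import Data.Nat.Primality
  using (Prime; euclidsLemma; prime?; prime⇒irreducible; prime⇒nonTrivial)
import Data.Nat.Properties as ℕ
import Data.Nat.Solver as ℕSolver
open import Data.Product using (_,_; _×_; proj₁; proj₂; Σ; ∃; ∃₂)
open import Data.Sum using ([_,_]′; _⊎_; inj₁; inj₂)
open import Function using (_∘_)
open import Relation.Binary.PropositionalEquality
open import Relation.Nullary using (Dec; _×-dec_; contradiction; no; yes; ¬?; ¬_)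
open import Relation.Nullary.Decidable using (from-yes)

-- The field is given only as a list of q³ elements, so its structure is obtained by counting.
-- Permuting the list yields the characteristic and the exponent of the multiplicative group, a root
-- bound for polynomials yields |F_q| = q, and comparing lengths of repetition-free lists takes the
-- place of dimension arguments. That ω lies in F_q is a matter of q modulo 3 together with N(ω) =
-- 1, which holds because ω = t^(q-1). If q is 1 modulo 3, every cube root of unity is in F_q;
-- otherwise the norm condition forces ω = 1. Type III for lines is reduced to Type III for points
-- by duality: Cramer's rule puts the coordinates of a line of π_λ into π_(λ²), and φ acts on line
-- coordinates by the same formula as on points. Passing to λ² is harmless, since it is again a cube
-- root of unity different from 1.

module _ {A : Set} where

  -- Each head of `xs` is cut out of `ys` in turn; as `xs` has no repetitions, its later entries
  -- survive the cut. All cardinality comparisons below rest on this.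
  ⊆⇒↭-++ : {xs ys : List A} → Unique xs → (∀ {x} → x ∈ xs → x ∈ ys) →
    ∃ λ zs → ys ↭ xs ++ zs
  ⊆⇒↭-++ {[]} {ys} _ _ = ys , ↭-refl
  ⊆⇒↭-++ {x ∷ xs} (x∉xs ∷ u) sub with ∈-∃++ (sub (here refl))
  ... | as , bs , refl =
    let zs , as++bs↭ = ⊆⇒↭-++ u sub′ in zs , ↭-trans (shift x as bs) (prep x as++bs↭)
    where
    sub′ : ∀ {y} → y ∈ xs → y ∈ as ++ bs
    sub′ y∈xs with ∈-resp-↭ (shift x as bs) (sub (there y∈xs))
    ... | here refl = contradiction refl (All.lookup x∉xs y∈xs)
    ... | there y∈  = y∈

  ⊆⇒length≤ : {xs ys : List A} → Unique xs → (∀ {x} → x ∈ xs → x ∈ ys) →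
    length xs ≤ length ys
  ⊆⇒length≤ {xs} u sub with ⊆⇒↭-++ u sub
  ... | zs , ys↭ = subst (length xs ≤_)
    (sym (trans (↭-length ys↭) (length-++ xs))) (ℕ.m≤m+n (length xs) (length zs))

  ⊆⊇⇒↭ : {xs ys : List A} → Unique xs → Unique ys →
    (∀ {x} → x ∈ xs → x ∈ ys) → (∀ {x} → x ∈ ys → x ∈ xs) → ys ↭ xs
  ⊆⊇⇒↭ {xs} {ys} uxs uys ⊆ ⊇ with ⊆⇒↭-++ uxs ⊆
  ... | [] , ys↭ = ↭-trans ys↭ (++-identityʳ xs)
  ... | z ∷ zs , ys↭ = ⊥-elim (ℕ.<-irrefl refl (ℕ.<-≤-trans
      (ℕ.m<m+n (length xs) (s≤s z≤n))
      (subst (_≤ length xs) (trans (↭-length ys↭) (length-++ xs)) (⊆⇒length≤ uys ⊇))))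

module _ {A : Set} {R : A → A → Set} where

  unique⇒allPairs : {xs : List A} →
    (∀ {x y} → x ∈ xs → y ∈ xs → ¬ (x ≡ y) → R x y) → Unique xs → AllPairs R xs
  unique⇒allPairs _   []       = []
  unique⇒allPairs hyp (x∉ ∷ u) =
    All.tabulate (λ y∈ → hyp (here refl) (there y∈) (All.lookup x∉ y∈))
    ∷ unique⇒allPairs (λ x∈ y∈ → hyp (there x∈) (there y∈)) u

module _ {A B C : Set} (f : A → B → C) where

  length-cartesianProductWith : ∀ xs ys →
    length (cartesianProductWith f xs ys) ≡ length xs ℕ.* length ys
  length-cartesianProductWith []       ys = refl
  length-cartesianProductWith (x ∷ xs) ys = trans (length-++ (map (f x) ys))
    (cong₂ ℕ._+_ (length-map (f x) ys) (length-cartesianProductWith xs ys))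

  -- Unlike the library's version, this one needs f to be injective on the two lists only.
  unique-cartesianProductWith : ∀ {xs ys} →
    (∀ {x x′ y y′} → x ∈ xs → x′ ∈ xs → y ∈ ys → y′ ∈ ys → f x y ≡ f x′ y′ → x ≡ x′ × y ≡ y′) →
    Unique xs → Unique ys → Unique (cartesianProductWith f xs ys)
  unique-cartesianProductWith inj [] uys = []
  unique-cartesianProductWith {x ∷ xs} {ys} inj (x∉ ∷ uxs) uys = Unique.++⁺
    (AllPairs.map⁺ (unique⇒allPairs
      (λ y∈ y′∈ y≢y′ eq → y≢y′ (proj₂ (inj (here refl) (here refl) y∈ y′∈ eq))) uys))
    (unique-cartesianProductWith (λ x∈ x′∈ → inj (there x∈) (there x′∈)) uxs uys)
    λ (v∈₁ , v∈₂) → disjoint v∈₁ v∈₂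
    where
    disjoint : ∀ {v} → v ∈ map (f x) ys → ¬ (v ∈ cartesianProductWith f xs ys)
    disjoint v∈₁ v∈₂ with ∈-map⁻ (f x) v∈₁ | ∈-cartesianProductWith⁻ f xs ys v∈₂
    ... | y , y∈ , refl | x′ , y′ , x′∈ , y′∈ , eq =
      All.lookup x∉ x′∈ (proj₁ (inj (here refl) (there x′∈) y∈ y′∈ eq))

-- Prime divisors of binomial coefficients, and arithmetic modulo 3

prime∤! : ∀ {p} → Prime p → ∀ n → n < p → ¬ (p ∣ n !)
prime∤! pp zero n<p p∣ =
  ℕ.<-irrefl refl (ℕ.<-≤-trans (ℕ.nonTrivial⇒n>1 _ {{prime⇒nonTrivial pp}}) (∣⇒≤ p∣))
prime∤! pp (suc n) n<p p∣ with euclidsLemma (suc n) (n !) pp p∣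
... | inj₁ p∣suc = ℕ.<-irrefl refl (ℕ.<-≤-trans n<p (∣⇒≤ p∣suc))
... | inj₂ p∣n!  = prime∤! pp n (ℕ.<-trans (ℕ.n<1+n n) n<p) p∣n!

-- The prime p divides p! = (p C k) k! (p-k)!, but neither factorial on the right, whose factors are
-- all smaller than p.
prime∣C : ∀ {p} → Prime p → ∀ k → 0 < k → k < p → p ∣ p C k
prime∣C {p@(suc p-1)} pp k 0<k k<p
  with euclidsLemma (p C k) (k ! ℕ.* (p ∸ k) !) pp
         (subst (p ∣_) (sym pCk*d≡p!) (m∣m*n (p-1 !)))
  where
  instance _ = ℕ.m*n≢0 (k !) ((p ∸ k) !) {{k ℕ.!≢0}} {{(p ∸ k) ℕ.!≢0}}
  pCk*d≡p! : (p C k) ℕ.* (k ! ℕ.* (p ∸ k) !) ≡ p !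
  pCk*d≡p! = trans (cong (ℕ._* (k ! ℕ.* (p ∸ k) !)) (nCk≡n!/k![n-k]! (ℕ.<⇒≤ k<p)))
                   (m/n*n≡m (k![n∸k]!∣n! (ℕ.<⇒≤ k<p)))
... | inj₁ p∣C = p∣C
... | inj₂ p∣d with euclidsLemma (k !) ((p ∸ k) !) pp p∣d
...   | inj₁ p∣k! = contradiction p∣k! (prime∤! pp k k<p)
...   | inj₂ p∣!  = contradiction p∣! (prime∤! pp (p ∸ k) (ℕ.∸-monoʳ-< 0<k (ℕ.<⇒≤ k<p)))

gcd-∣ : ∀ {m n} → m ∣ n → gcd m n ≡ m
gcd-∣ {m} {n} m∣n = ∣-antisym (gcd[m,n]∣m m n) (gcd-greatest ∣-refl m∣n)

gcd₃-∤ : ∀ {n} → ¬ (3 ∣ n) → gcd 3 n ≡ 1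
gcd₃-∤ {n} 3∤n with prime⇒irreducible (from-yes (prime? 3)) (gcd[m,n]∣m 3 n)
... | inj₁ ≡1 = ≡1
... | inj₂ ≡3 = contradiction (subst (_∣ n) ≡3 (gcd[m,n]∣n 3 n)) 3∤n

-- The multiple of 3 is kept as a separate summand so that it disappears from the exponent of a cube
-- root of unity.
residue₃ : ∀ n → ∃₂ λ r m → n ≡ r ℕ.+ m ℕ.* 3 × (r ≡ 0 ⊎ r ≡ 1 ⊎ r ≡ 2)
residue₃ 0 = 0 , 0 , refl , inj₁ refl
residue₃ 1 = 1 , 0 , refl , inj₂ (inj₁ refl)
residue₃ 2 = 2 , 0 , refl , inj₂ (inj₂ refl)
residue₃ (suc (suc (suc n))) with residue₃ n
... | r , m , refl , r≡ = r , suc m ,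
  ℕS.solve 2 (λ r m → ℕS.con 3 ℕS.:+ (r ℕS.:+ m) ℕS.:= r ℕS.:+ (ℕS.con 3 ℕS.:+ m)) refl r (m ℕ.* 3) , r≡
  where module ℕS = ℕSolver.+-*-Solver

-- The exponent q is a parameter only because PG.pow depends on it.
module Field (F : FiniteField) (q : ℕ) where
  open FiniteField F
  open PG F q

  commutativeRing : CommutativeRing _ _
  commutativeRing = record { isCommutativeRing = isCommutativeRing }

  open CommutativeRing commutativeRing public
    using ( semiring; commutativeSemiring; ring; +-monoid
          ; *-comm; *-assoc; *-identityˡ; *-identityʳ; zeroˡ; zeroʳ
          ; +-comm; +-assoc; +-identityˡ; +-identityʳ; -‿inverseʳ
          ; distribˡ; distribʳ
          ; +-isCommutativeMonoid; *-isCommutativeMonoid)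
  open RingProperties ring public using (+-cancelˡ; +-cancelʳ; -‿distribʳ-*)
  open MonoidMult +-monoid public using () renaming (_×_ to _·_)
  open SemiringMult semiring public using (×1-homo-*; ×-assoc-*)
  open NatSolver commutativeSemiring public
    using (solve; _:=_; _:+_; _:*_; con)

  *-cancelˡ : ∀ {x y z} → ¬ (x ≡ 0#) → x * y ≡ x * z → y ≡ z
  *-cancelˡ {x} {y} {z} x≢0 eq = trans (trans (step y) (cong (x⁻¹ *_) eq)) (sym (step z))
    where
    x⁻¹ = proj₁ (inverse x x≢0)
    step : ∀ w → w ≡ x⁻¹ * (x * w)
    step w = trans (sym (*-identityˡ w)) (trans (cong (_* w) (sym (proj₂ (inverse x x≢0))))
      (solve 3 (λ a b c → a :* b :* c := b :* (a :* c)) refl x x⁻¹ w))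

  *-cancelʳ : ∀ {x y z} → ¬ (x ≡ 0#) → y * x ≡ z * x → y ≡ z
  *-cancelʳ {x} {y} {z} x≢0 eq = *-cancelˡ x≢0 (trans (*-comm x y) (trans eq (*-comm z x)))

  *-≡0 : ∀ {x y} → x * y ≡ 0# → x ≡ 0# ⊎ y ≡ 0#
  *-≡0 {x} {y} eq with x ≟ 0#
  ... | yes x≡0 = inj₁ x≡0
  ... | no x≢0  = inj₂ (*-cancelˡ x≢0 (trans eq (sym (zeroʳ x))))

  *-≢0 : ∀ {x y} → ¬ (x ≡ 0#) → ¬ (y ≡ 0#) → ¬ (x * y ≡ 0#)
  *-≢0 x≢0 y≢0 eq with *-≡0 eq
  ... | inj₁ x≡0 = x≢0 x≡0
  ... | inj₂ y≡0 = y≢0 y≡0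

  1≢0 : ¬ (1# ≡ 0#)
  1≢0 = 0≢1 ∘ sym

  *≡1⇒≢0 : ∀ {x y} → x * y ≡ 1# → ¬ (x ≡ 0#)
  *≡1⇒≢0 {y = y} eq refl = 0≢1 (trans (sym (zeroˡ y)) eq)

  *≢0⇒≢0ˡ : ∀ {x y} → ¬ (x * y ≡ 0#) → ¬ (x ≡ 0#)
  *≢0⇒≢0ˡ {_} {y} xy≢0 refl = xy≢0 (zeroˡ y)

  pow-+ : ∀ x m n → pow x (m ℕ.+ n) ≡ pow x m * pow x n
  pow-+ x zero    n = sym (*-identityˡ _)
  pow-+ x (suc m) n = trans (cong (x *_) (pow-+ x m n)) (sym (*-assoc x _ _))

  pow-* : ∀ x m n → pow x (m ℕ.* n) ≡ pow (pow x n) m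
  pow-* x zero    n = refl
  pow-* x (suc m) n = trans (pow-+ x n (m ℕ.* n)) (cong (pow x n *_) (pow-* x m n))

  pow-distrib-* : ∀ x y n → pow (x * y) n ≡ pow x n * pow y n
  pow-distrib-* x y zero    = sym (*-identityˡ _)
  pow-distrib-* x y (suc n) = trans (cong (x * y *_) (pow-distrib-* x y n))
    (solve 4 (λ a b c d → a :* b :* (c :* d) := a :* c :* (b :* d)) refl x y _ _)

  pow-1# : ∀ n → pow 1# n ≡ 1#
  pow-1# zero    = refl
  pow-1# (suc n) = trans (*-identityˡ _) (pow-1# n)

  pow-≢0 : ∀ {x} n → ¬ (x ≡ 0#) → ¬ (pow x n ≡ 0#)
  pow-≢0 zero    x≢0 = 1≢0
  pow-≢0 (suc n) x≢0 = *-≢0 x≢0 (pow-≢0 n x≢0)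

  pow≡^ : ∀ x n → pow x n ≡ SemiringExp._^_ semiring x n
  pow≡^ x zero    = refl
  pow≡^ x (suc n) = cong (x *_) (pow≡^ x n)

  -- Characteristic and multiplicative exponent from permutations of the elements

  module Perm = PermutationSetoid (setoid Carrier)

  translate-↭ : ∀ a → map (a +_) elements ↭ elements
  translate-↭ a = ⊆⊇⇒↭ elements-unique (Unique.map⁺ (+-cancelˡ a _ _) elements-unique)
    (λ {x} _ → subst (_∈ map (a +_) elements) (a+[-a+x]≡x x) (∈-map⁺ (a +_) (elements-complete (- a + x))))
    (λ _ → elements-complete _)
    where
    a+[-a+x]≡x : ∀ x → a + (- a + x) ≡ x
    a+[-a+x]≡x x = trans (sym (+-assoc a (- a) x)) (trans (cong (_+ x) (-‿inverseʳ a)) (+-identityˡ x))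

  sum-translate : ∀ a xs → foldr _+_ 0# (map (a +_) xs) ≡ length xs · a + foldr _+_ 0# xs
  sum-translate a []       = sym (+-identityˡ _)
  sum-translate a (x ∷ xs) = trans (cong (a + x +_) (sum-translate a xs))
    (solve 4 (λ a x n s → a :+ x :+ (n :+ s) := a :+ n :+ (x :+ s)) refl a x _ _)

  -- Translation by 1 permutes the field, so the sum of all elements is unchanged when `card` copies
  -- of 1 are added to it.
  card·1≡0 : card · 1# ≡ 0#
  card·1≡0 = +-cancelʳ (foldr _+_ 0# elements) _ _ (trans (sym (sum-translate 1# elements))
    (trans (Perm.foldr-commMonoid +-isCommutativeMonoid (↭⇒↭ₛ (translate-↭ 1#)))
           (sym (+-identityˡ _))))

  nonzeros : List Carrier
  nonzeros = filter (λ x → ¬? (x ≟ 0#)) elements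

  ∈-nonzeros : ∀ {x} → ¬ (x ≡ 0#) → x ∈ nonzeros
  ∈-nonzeros = ∈-filter⁺ (λ x → ¬? (x ≟ 0#)) (elements-complete _)

  nonzeros-≢0 : ∀ {x} → x ∈ nonzeros → ¬ (x ≡ 0#)
  nonzeros-≢0 x∈ = proj₂ (∈-filter⁻ (λ x → ¬? (x ≟ 0#)) {xs = elements} x∈)

  nonzeros-unique : Unique nonzeros
  nonzeros-unique = Unique.filter⁺ (λ x → ¬? (x ≟ 0#)) elements-unique

  length-nonzeros : suc (length nonzeros) ≡ card
  length-nonzeros = sym (↭-length {ys = 0# ∷ nonzeros} (⊆⊇⇒↭
      (All.tabulate (λ {x} x∈ 0≡x → nonzeros-≢0 x∈ (sym 0≡x)) ∷ nonzeros-unique)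
      elements-unique (λ _ → elements-complete _) (λ {x} _ → split x)))
    where
    split : ∀ x → x ∈ 0# ∷ nonzeros
    split x with x ≟ 0#
    ... | yes refl = here refl
    ... | no x≢0   = there (∈-nonzeros x≢0)

  scale-↭ : ∀ {a} → ¬ (a ≡ 0#) → map (a *_) nonzeros ↭ nonzeros
  scale-↭ {a} a≢0 = ⊆⊇⇒↭ nonzeros-unique (Unique.map⁺ (*-cancelˡ a≢0) nonzeros-unique) ⊆ ⊇
    where
    ⊆ : ∀ {x} → x ∈ nonzeros → x ∈ map (a *_) nonzeros
    ⊆ {x} x∈ = let a⁻¹ , aa⁻¹≡1 = inverse a a≢0
                   eq = trans (sym (*-assoc a a⁻¹ x)) (trans (cong (_* x) aa⁻¹≡1) (*-identityˡ x))
      in subst (_∈ map (a *_) nonzeros) eq (∈-map⁺ (a *_) (∈-nonzeros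
           (λ z → nonzeros-≢0 x∈ (trans (sym eq) (trans (cong (a *_) z) (zeroʳ a))))))
    ⊇ : ∀ {x} → x ∈ map (a *_) nonzeros → x ∈ nonzeros
    ⊇ x∈ with ∈-map⁻ (a *_) x∈
    ... | y , y∈ , refl = ∈-nonzeros (*-≢0 a≢0 (nonzeros-≢0 y∈))

  product-scale : ∀ a xs → foldr _*_ 1# (map (a *_) xs) ≡ pow a (length xs) * foldr _*_ 1# xs
  product-scale a []       = sym (*-identityˡ _)
  product-scale a (x ∷ xs) = trans (cong (a * x *_) (product-scale a xs))
    (solve 4 (λ a x n s → a :* x :* (n :* s) := a :* n :* (x :* s)) refl a x _ _)

  product-≢0 : ∀ {xs} → All (λ x → ¬ (x ≡ 0#)) xs → ¬ (foldr _*_ 1# xs ≡ 0#)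
  product-≢0 []         = 1≢0
  product-≢0 (x≢0 ∷ xs) = *-≢0 x≢0 (product-≢0 xs)

  -- Multiplication by a permutes the nonzero elements; comparing the two products and cancelling
  -- the nonzero product of all of them leaves the power of a.
  pow-length-nonzeros : ∀ {a} → ¬ (a ≡ 0#) → pow a (length nonzeros) ≡ 1#
  pow-length-nonzeros {a} a≢0 = *-cancelʳ (product-≢0 (All.tabulate nonzeros-≢0))
    (trans (sym (product-scale a nonzeros))
    (trans (Perm.foldr-commMonoid *-isCommutativeMonoid (↭⇒↭ₛ (scale-↭ a≢0)))
           (sym (*-identityˡ _))))

  -- Polynomial functions and the number of their roots

  -- Functions given by a polynomial of degree at most n whose coefficient at n is a.
  data Poly (a : Carrier) : ℕ → (Carrier → Carrier) → Set where
    const : ∀ {f} → (∀ x → f x ≡ a) → Poly a zero f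
    step  : ∀ {n f} g c → Poly a n g → (∀ x → f x ≡ x * g x + c) → Poly a (suc n) f

  -- The last equation is f x − f r = (x − r) g x, written without subtraction.
  divide : ∀ {a n f} → Poly a (suc n) f → ∀ r →
    ∃ λ g → Poly a n g × (∀ x → f x + r * g x ≡ x * g x + f r)
  divide {a} {f = f} (step g c (const g≡a) f≡) r = (λ _ → a) , const (λ _ → refl) , eq
    where
    eq : ∀ x → f x + r * a ≡ x * a + f r
    eq x rewrite f≡ x | f≡ r | g≡a x | g≡a r =
      solve 4 (λ x a c r → x :* a :+ c :+ r :* a := x :* a :+ (r :* a :+ c)) refl x a c r
  divide {a} {f = f} (step g c pg@(step _ _ _ _) f≡) r with divide pg r
  ... | h , ph , h≡ = (λ x → x * h x + g r) , step h (g r) ph (λ _ → refl) , eq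
    where
    eq : ∀ x → f x + r * (x * h x + g r) ≡ x * (x * h x + g r) + f r
    eq x rewrite f≡ x | f≡ r = trans
      (solve 6 (λ x G c r H R → x :* G :+ c :+ r :* (x :* H :+ R) := x :* (G :+ r :* H) :+ (r :* R :+ c))
             refl x (g x) c r (h x) (g r))
      (cong (λ w → x * w + (r * g r + c)) (h≡ x))

  -- One root r is divided out. At another root x the division identity reads r g x = x g x, so g x
  -- ≠ 0 would force x = r; hence the remaining roots are roots of g.
  roots-bound : ∀ {a n f xs} → ¬ (a ≡ 0#) → Poly a n f → Unique xs →
    (∀ {x} → x ∈ xs → f x ≡ 0#) → length xs ≤ n
  roots-bound {xs = []} _ _ _ _ = z≤n
  roots-bound {xs = x ∷ xs} a≢0 (const f≡a) _ root =
    contradiction (trans (sym (f≡a x)) (root (here refl))) a≢0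
  roots-bound {f = f} {xs = r ∷ xs} a≢0 pf@(step _ _ _ _) (r∉xs ∷ u) root with divide pf r
  ... | g , pg , g≡ = s≤s (roots-bound a≢0 pg u g-root)
    where
    g-root : ∀ {x} → x ∈ xs → g x ≡ 0#
    g-root {x} x∈ with g x ≟ 0#
    ... | yes gx≡0 = gx≡0
    ... | no gx≢0  = contradiction
      (*-cancelʳ gx≢0 (trans (sym (+-identityˡ _)) (trans (cong (_+ r * g x) (sym (root (there x∈))))
        (trans (g≡ x) (trans (cong (x * g x +_) (root (here refl))) (+-identityʳ _))))))
      (All.lookup r∉xs x∈)

  Poly-resp : ∀ {a n f g} → (∀ x → g x ≡ f x) → Poly a n f → Poly a n g
  Poly-resp g≡f (const f≡)      = const (λ x → trans (g≡f x) (f≡ x))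
  Poly-resp g≡f (step h c p f≡) = step h c p (λ x → trans (g≡f x) (f≡ x))

  Poly-pow : ∀ n → Poly 1# n (λ x → pow x n)
  Poly-pow zero    = const (λ _ → refl)
  Poly-pow (suc n) = step _ 0# (Poly-pow n) (λ x → sym (+-identityʳ _))

  Poly-scale : ∀ {a n f} c → Poly a n f → Poly (c * a) n (λ x → c * f x)
  Poly-scale c (const f≡)      = const (λ x → cong (c *_) (f≡ x))
  Poly-scale c (step g d p f≡) = step _ (c * d) (Poly-scale c p) (λ x → trans (cong (c *_) (f≡ x))
    (solve 4 (λ c x g d → c :* (x :* g :+ d) := x :* (c :* g) :+ c :* d) refl c x (g x) d))

  Poly-pow-* : ∀ {a n f} m → Poly a n f → Poly a (m ℕ.+ n) (λ x → pow x m * f x)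
  Poly-pow-* zero    p = Poly-resp (λ _ → *-identityˡ _) p
  Poly-pow-* (suc m) p = step _ 0# (Poly-pow-* m p)
    (λ x → trans (*-assoc x _ _) (sym (+-identityʳ _)))

  -- A leading coefficient 0 makes the index a mere upper bound for the degree, so that polynomials
  -- of different degrees can be brought to a common index and added.
  Poly-pad : ∀ {a n m f} → n < m → Poly a n f → Poly 0# m f
  Poly-pad {a} {m = suc m} _ (const f≡) = step (λ _ → 0#) a (zeros m)
    (λ x → trans (f≡ x) (sym (trans (cong (_+ a) (zeroʳ x)) (+-identityˡ a))))
    where
    zeros : ∀ m → Poly 0# m (λ _ → 0#)
    zeros zero    = const (λ _ → refl)
    zeros (suc m) = step _ 0# (zeros m) (λ x → sym (trans (+-identityʳ _) (zeroʳ x)))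
  Poly-pad (s≤s n<m) (step g c p f≡) = step g c (Poly-pad n<m p) f≡

  Poly-+ : ∀ {a b n f g} → Poly a n f → Poly b n g → Poly (a + b) n (λ x → f x + g x)
  Poly-+ (const f≡) (const g≡) = const (λ x → cong₂ _+_ (f≡ x) (g≡ x))
  Poly-+ (step f′ c p f≡) (step g′ d r g≡) = step _ (c + d) (Poly-+ p r)
    (λ x → trans (cong₂ _+_ (f≡ x) (g≡ x))
      (solve 5 (λ x f g c d → x :* f :+ c :+ (x :* g :+ d) := x :* (f :+ g) :+ (c :+ d))
             refl x (f′ x) (g′ x) c d))

  Poly-+-lower : ∀ {a b m n f g} → m < n → Poly a n f → Poly b m g → Poly a n (λ x → f x + g x)
  Poly-+-lower {a} {n = n} m<n p r =
    subst (λ c → Poly c n _) (+-identityʳ a) (Poly-+ p (Poly-pad m<n r))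

  -- Additivity of the Frobenius map

  module _ {p} (pp : Prime p) (p·1≡0 : p · 1# ≡ 0#) where

    ∣⇒·≡0 : ∀ {n} → p ∣ n → ∀ x → n · x ≡ 0#
    ∣⇒·≡0 {n} (divides d refl) x = begin
      n · x                       ≡⟨ cong (n ·_) (sym (*-identityˡ x)) ⟩
      n · (1# * x)                ≡⟨ sym (×-assoc-* n 1# x) ⟩
      (n · 1#) * x                ≡⟨ cong (_* x) (×1-homo-* d p) ⟩
      (d · 1#) * (p · 1#) * x     ≡⟨ cong (λ w → (d · 1#) * w * x) p·1≡0 ⟩
      (d · 1#) * 0# * x           ≡⟨ cong (_* x) (zeroʳ _) ⟩
      0# * x                      ≡⟨ zeroˡ x ⟩
      0#                          ∎
      where open ≡-Reasoning

    frobenius-+ : ∀ x y → pow (x + y) p ≡ pow x p + pow y p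
    frobenius-+ x y = trans (pow≡^ (x + y) p) (trans (B.theorem p x y) (expand p refl))
      where
      module B = Binomial commutativeSemiring
      open MonoidSum +-monoid using (sum; sum-cong-≗; sum-init-last; sum-replicate-zero)
      open ≡-Reasoning
      -- Stated for any `n` equal to p, so that matching exposes a successor. The sum then splits
      -- into its two end terms and the inner terms, whose coefficients are divisible by p.
      expand : ∀ n → n ≡ p → B.binomialExpansion x y n ≡ pow x n + pow y n
      expand zero refl = contradiction (ℕ.nonTrivial⇒n>1 0 {{prime⇒nonTrivial pp}}) (λ ())
      expand (suc m) refl = begin
        t Fin.zero + sum (t ∘ Fin.suc)
          ≡⟨ cong (t Fin.zero +_) (sum-init-last (t ∘ Fin.suc)) ⟩
        t Fin.zero + (sum (λ i → t (Fin.suc (Fin.inject₁ i))) + t (Fin.fromℕ (suc m)))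
          ≡⟨ cong₂ (λ a b → a + (b + t (Fin.fromℕ (suc m)))) first
               (trans (sum-cong-≗ middle) (sum-replicate-zero m)) ⟩
        pow y (suc m) + (0# + t (Fin.fromℕ (suc m)))
          ≡⟨ cong (pow y (suc m) +_) (trans (+-identityˡ _) last) ⟩
        pow y (suc m) + pow x (suc m)
          ≡⟨ +-comm _ _ ⟩
        pow x (suc m) + pow y (suc m) ∎
        where
        t = B.binomialTerm x y (suc m)
        first : t Fin.zero ≡ pow y (suc m)
        first = trans (+-identityʳ _) (trans (*-identityˡ _) (sym (pow≡^ y (suc m))))
        last : t (Fin.fromℕ (suc m)) ≡ pow x (suc m)
        last rewrite Fin.toℕ-fromℕ m | nCn≡1 (suc m) | ℕ.n∸n≡0 m =
          trans (+-identityʳ _) (trans (*-identityʳ _) (sym (pow≡^ x (suc m))))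
        middle : ∀ i → t (Fin.suc (Fin.inject₁ i)) ≡ 0#
        middle i = ∣⇒·≡0 (prime∣C pp (suc (toℕ (Fin.inject₁ i))) (s≤s z≤n)
          (s≤s (subst (_< m) (sym (Fin.toℕ-inject₁ i)) (Fin.toℕ<n i)))) _

    frobenius^-+ : ∀ k x y → pow (x + y) (p ^ k) ≡ pow x (p ^ k) + pow y (p ^ k)
    frobenius^-+ zero    x y = solve 2 (λ x y → (x :+ y) :* con 1 := x :* con 1 :+ y :* con 1) refl x y
    frobenius^-+ (suc k) x y = begin
      pow (x + y) (p ^ suc k)                         ≡⟨ pow-* (x + y) p (p ^ k) ⟩
      pow (pow (x + y) (p ^ k)) p                     ≡⟨ cong (λ w → pow w p) (frobenius^-+ k x y) ⟩
      pow (pow x (p ^ k) + pow y (p ^ k)) p           ≡⟨ frobenius-+ _ _ ⟩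
      pow (pow x (p ^ k)) p + pow (pow y (p ^ k)) p   ≡⟨ sym (cong₂ _+_ (pow-* x p (p ^ k)) (pow-* y p (p ^ k))) ⟩
      pow x (p ^ suc k) + pow y (p ^ suc k)           ∎
      where open ≡-Reasoning

module CubicExtension (F : FiniteField) (q p k : ℕ) (pp : Prime p) (k≥1 : k ≥ 1) (q≡p^k : q ≡ p ^ k)
                      (card≡q³ : FiniteField.card F ≡ q ^ 3) where
  open FiniteField F
  open PG F q
  open Field F q
  open ≡-Reasoning

  1<p : 1 < p
  1<p = ℕ.nonTrivial⇒n>1 p {{prime⇒nonTrivial pp}}

  1<q : 1 < q
  1<q = subst (1 <_) (sym q≡p^k) (ℕ.<-≤-trans 1<p
    (subst (_≤ p ^ k) (ℕ.^-identityʳ p)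
      (ℕ.^-monoʳ-≤ p {{ℕ.>-nonZero (ℕ.<-trans (s≤s z≤n) 1<p)}} k≥1)))

  instance
    q-nonZero : ℕ.NonZero q
    q-nonZero = ℕ.>-nonZero (ℕ.<-trans (s≤s z≤n) 1<q)

  q<q² : q < q ℕ.* q
  q<q² = subst (_< q ℕ.* q) (ℕ.*-identityʳ q) (ℕ.*-monoʳ-< q 1<q)

  q²<card : q ℕ.* q < card
  q²<card = subst (q ℕ.* q <_) (trans (cong (λ w → q ℕ.* (q ℕ.* w)) (sym (ℕ.*-identityʳ q))) (sym card≡q³))
    (ℕ.*-monoʳ-< q q<q²)

  -- The Frobenius map x ↦ x^q and the subfield F_q

  ^·1 : ∀ m n → (m ^ n) · 1# ≡ pow (m · 1#) n
  ^·1 m zero    = +-identityʳ 1#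
  ^·1 m (suc n) = trans (×1-homo-* m (m ^ n)) (cong (m · 1# *_) (^·1 m n))

  -- A field has no nilpotent elements. Used twice, this brings q³·1 = 0 down to q·1 = 0 and then to
  -- p·1 = 0.
  ^·1≡0 : ∀ m n → (m ^ n) · 1# ≡ 0# → m · 1# ≡ 0#
  ^·1≡0 m n m^n·1≡0 with (m · 1#) ≟ 0#
  ... | yes m·1≡0 = m·1≡0
  ... | no m·1≢0  = contradiction (trans (sym (^·1 m n)) m^n·1≡0) (pow-≢0 n m·1≢0)

  q·1≡0 : q · 1# ≡ 0#
  q·1≡0 = ^·1≡0 q 3 (subst (λ n → n · 1# ≡ 0#) card≡q³ card·1≡0)

  p·1≡0 : p · 1# ≡ 0#
  p·1≡0 = ^·1≡0 p k (subst (λ n → n · 1# ≡ 0#) q≡p^k q·1≡0)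

  fr-+ : ∀ x y → fr (x + y) ≡ fr x + fr y
  fr-+ x y = subst (λ n → pow (x + y) n ≡ pow x n + pow y n) (sym q≡p^k) (frobenius^-+ pp p·1≡0 k x y)

  fr-* : ∀ x y → fr (x * y) ≡ fr x * fr y
  fr-* x y = pow-distrib-* x y q

  fr-0 : fr 0# ≡ 0#
  fr-0 = +-cancelˡ (fr 0#) _ _ (trans (sym (fr-+ 0# 0#)) (trans (cong fr (+-identityʳ 0#)) (sym (+-identityʳ _))))

  fr-1 : fr 1# ≡ 1#
  fr-1 = pow-1# q

  fr-≢0 : ∀ {x} → ¬ (x ≡ 0#) → ¬ (fr x ≡ 0#)
  fr-≢0 = pow-≢0 q

  +≡0⇒≡- : ∀ {x y} → x + y ≡ 0# → y ≡ - x
  +≡0⇒≡- {x} {y} eq = +-cancelˡ x _ _ (trans eq (sym (-‿inverseʳ x)))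

  fr-neg : ∀ x → fr (- x) ≡ - fr x
  fr-neg x = +≡0⇒≡- (trans (sym (fr-+ x (- x))) (trans (cong fr (-‿inverseʳ x)) fr-0))

  pow-card : ∀ x → pow x card ≡ x
  pow-card x with x ≟ 0#
  ... | yes refl = subst (λ n → pow 0# n ≡ 0#) length-nonzeros (zeroˡ _)
  ... | no x≢0   = subst (λ n → pow x n ≡ x) length-nonzeros
    (trans (cong (x *_) (pow-length-nonzeros x≢0)) (*-identityʳ x))

  pow-q² : ∀ x → pow x (q ℕ.* q) ≡ fr (fr x)
  pow-q² x = pow-* x q q

  fr³ : ∀ x → fr (fr (fr x)) ≡ x
  fr³ x = begin
    fr (fr (fr x))                  ≡⟨ cong fr (sym (pow-q² x)) ⟩
    fr (pow x (q ℕ.* q))            ≡⟨ sym (pow-* x q (q ℕ.* q)) ⟩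
    pow x (q ℕ.* (q ℕ.* q))         ≡⟨ cong (λ w → pow x (q ℕ.* (q ℕ.* w))) (sym (ℕ.*-identityʳ q)) ⟩
    pow x (q ^ 3)                   ≡⟨ cong (pow x) (sym card≡q³) ⟩
    pow x card                      ≡⟨ pow-card x ⟩
    x                               ∎

  fr-inverse : ∀ {x y} → x * y ≡ 1# → fr x * fr y ≡ 1#
  fr-inverse {x} {y} xy≡1 = trans (sym (fr-* x y)) (trans (cong fr xy≡1) fr-1)

  InFq? : ∀ x → Dec (InFq x)
  InFq? x = fr x ≟ x

  InFq-0 : InFq 0#
  InFq-0 = fr-0

  InFq-+ : ∀ {x y} → InFq x → InFq y → InFq (x + y)
  InFq-+ {x} {y} fx fy = trans (fr-+ x y) (cong₂ _+_ fx fy)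

  InFq-* : ∀ {x y} → InFq x → InFq y → InFq (x * y)
  InFq-* {x} {y} fx fy = trans (fr-* x y) (cong₂ _*_ fx fy)

  InFq-neg : ∀ {x} → InFq x → InFq (- x)
  InFq-neg {x} fx = trans (fr-neg x) (cong -_ fx)

  InFq-inverse : ∀ {x y} → x * y ≡ 1# → InFq x → InFq y
  InFq-inverse {x} {y} xy≡1 fx = *-cancelˡ (*≡1⇒≢0 xy≡1)
    (trans (cong (_* fr y) (sym fx)) (trans (fr-inverse xy≡1) (sym xy≡1)))

  -- geometric n y = 1 + y + ⋯ + yⁿ
  geometric : ℕ → Carrier → Carrier
  geometric zero    y = 1#
  geometric (suc n) y = y * geometric n y + 1#

  -- The identity (y - 1)(1 + ⋯ + yⁿ) = yⁿ⁺¹ - 1 without subtraction: both sides are 1 + y + ⋯ +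
  -- yⁿ⁺¹.
  geometric-telescope : ∀ n y → y * geometric n y + 1# ≡ geometric n y + pow y (suc n)
  geometric-telescope zero    y = +-comm _ 1#
  geometric-telescope (suc n) y = trans (cong (λ w → y * w + 1#) (geometric-telescope n y))
    (solve 3 (λ y g r → y :* (g :+ r) :+ con 1 := y :* g :+ con 1 :+ y :* r) refl y (geometric n y) _)

  root-of-unity : ∀ n y → pow y (suc n) ≡ 1# → y ≡ 1# ⊎ geometric n y ≡ 0#
  root-of-unity n y yⁿ≡1 with geometric n y ≟ 0#
  ... | yes g≡0 = inj₂ g≡0
  ... | no g≢0  = inj₁ (*-cancelʳ g≢0 (trans (+-cancelʳ 1# _ _
    (trans (geometric-telescope n y) (cong (geometric n y +_) yⁿ≡1))) (sym (*-identityˡ _))))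

  -- A Horner scheme in y = x^(m+1). The exponent is a successor so that one factor x can be split
  -- off for the `step` constructor.
  Poly-geometric : ∀ n m → Poly 1# (n ℕ.* suc m) (λ x → geometric n (pow x (suc m)))
  Poly-geometric zero    m = const (λ _ → refl)
  Poly-geometric (suc n) m = step _ 1# (Poly-pow-* m (Poly-geometric n m))
    (λ x → cong (_+ 1#) (*-assoc x _ _))

  Fq : List Carrier
  Fq = filter InFq? elements

  ∈-Fq : ∀ {x} → InFq x → x ∈ Fq
  ∈-Fq = ∈-filter⁺ InFq? (elements-complete _)

  Fq-InFq : ∀ {x} → x ∈ Fq → InFq x
  Fq-InFq x∈ = proj₂ (∈-filter⁻ InFq? {xs = elements} x∈)

  Fq-unique : Unique Fq
  Fq-unique = Unique.filter⁺ InFq? elements-unique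

  length-Fq≤q : length Fq ≤ q
  length-Fq≤q = roots-bound 1≢0 (Poly-+-lower 1<q (Poly-pow q) (Poly-scale (- 1#) (Poly-pow 1)))
    Fq-unique λ {x} x∈ → trans (cong (_+ - 1# * (x * 1#)) (Fq-InFq x∈))
      (trans (cong (_+ - 1# * (x * 1#)) (sym (trans (*-identityˡ _) (*-identityʳ x))))
      (trans (sym (distribʳ (x * 1#) 1# (- 1#)))
      (trans (cong (_* (x * 1#)) (-‿inverseʳ 1#)) (zeroˡ _))))

  -- x^(q−1) is a (q²+q+1)-th root of unity for every x ≠ 0.  Those x for which it is not 1 are
  -- roots of a polynomial of degree (q−1)(q²+q), which leaves at least q−1 nonzero elements of F_q.
  q≤length-Fq : q ≤ length Fq
  q≤length-Fq = bound q refl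
    where
    bound : ∀ q′ → q′ ≡ q → q′ ≤ length Fq
    bound zero _ = z≤n
    bound (suc m) q′≡q = q≤
      where
      -- Here q = m + 1 and n = q² + q, so that q³ - 1 = (n + 1) m.
      n : ℕ
      n = suc m ℕ.* suc m ℕ.+ suc m
      one? : ∀ x → Dec (pow x m ≡ 1#)
      one? x = pow x m ≟ 1#
      geo? : ∀ x → Dec (geometric n (pow x m) ≡ 0#)
      geo? x = geometric n (pow x m) ≟ 0#
      A B : List Carrier
      A = filter one? nonzeros
      B = filter geo? nonzeros
      length-nonzeros≡ : length nonzeros ≡ suc n ℕ.* m
      length-nonzeros≡ = ℕ.suc-injective (trans length-nonzeros (trans card≡q³
        (trans (cong (_^ 3) (sym q′≡q)) (ℕS.solve 1 (λ m →
          (ℕS.con 1 ℕS.:+ m) ℕS.:* ((ℕS.con 1 ℕS.:+ m) ℕS.:* ((ℕS.con 1 ℕS.:+ m) ℕS.:* ℕS.con 1))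
          ℕS.:= ℕS.con 1 ℕS.:+ (ℕS.con 1 ℕS.:+ ((ℕS.con 1 ℕS.:+ m) ℕS.:* (ℕS.con 1 ℕS.:+ m) ℕS.:+ (ℕS.con 1 ℕS.:+ m))) ℕS.:* m)
          refl m))))
        where module ℕS = ℕSolver.+-*-Solver
      covered : ∀ {x} → x ∈ nonzeros → x ∈ A ++ B
      covered {x} x∈ = [ (λ y≡1 → ∈-++⁺ˡ (∈-filter⁺ one? x∈ y≡1))
                       , (λ g≡0 → ∈-++⁺ʳ A (∈-filter⁺ geo? x∈ g≡0)) ]′
        (root-of-unity n (pow x m) (trans (sym (pow-* x (suc n) m))
          (trans (cong (pow x) (sym length-nonzeros≡)) (pow-length-nonzeros (nonzeros-≢0 x∈)))))
      0<m : 0 < m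
      0<m = ℕ.≤-pred (subst (1 <_) (sym q′≡q) 1<q)
      Poly-geo : ∀ m → 0 < m → Poly 1# (n ℕ.* m) (λ x → geometric n (pow x m))
      Poly-geo (suc m) _ = Poly-geometric n m
      length-B : length B ≤ n ℕ.* m
      length-B = roots-bound 1≢0 (Poly-geo m 0<m) (Unique.filter⁺ geo? nonzeros-unique)
        (λ x∈ → proj₂ (∈-filter⁻ geo? {xs = nonzeros} x∈))
      m≤length-A : m ≤ length A
      m≤length-A = ℕ.+-cancelʳ-≤ (n ℕ.* m) m (length A) (ℕ.≤-trans
        (subst₂ _≤_ length-nonzeros≡ (length-++ A) (⊆⇒length≤ nonzeros-unique covered))
        (ℕ.+-monoʳ-≤ (length A) length-B))
      A⊆Fq : ∀ {x} → x ∈ 0# ∷ A → x ∈ Fq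
      A⊆Fq (here refl) = ∈-Fq InFq-0
      A⊆Fq {x} (there x∈) = ∈-Fq (trans (cong (pow x) (sym q′≡q))
        (trans (cong (x *_) (proj₂ (∈-filter⁻ one? {xs = nonzeros} x∈))) (*-identityʳ x)))
      q≤ : suc m ≤ length Fq
      q≤ = ℕ.≤-trans (s≤s m≤length-A) (⊆⇒length≤ {xs = 0# ∷ A}
        (All.tabulate (λ {x} x∈ 0≡x → nonzeros-≢0 (proj₁ (∈-filter⁻ one? {xs = nonzeros} x∈)) (sym 0≡x))
          ∷ Unique.filter⁺ one? nonzeros-unique) A⊆Fq)

  length-Fq : length Fq ≡ q
  length-Fq = ℕ.≤-antisym length-Fq≤q q≤length-Fq

  -- Linearized polynomials and their roots

  infix 4 _∈?_
  _∈?_ : ∀ x xs → Dec (x ∈ xs)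
  _∈?_ = DecMembership._∈?_ _≟_

  fresh : ∀ xs → length xs < card → ∃ λ x → x ∉ xs
  fresh xs length<card with any? (λ x → ¬? (x ∈? xs)) elements
  ... | yes any = Any.satisfied any
  ... | no ¬any = contradiction (⊆⇒length≤ elements-unique ⊆) (ℕ.<⇒≱ length<card)
    where
    ⊆ : ∀ {x} → x ∈ elements → x ∈ xs
    ⊆ {x} x∈ with x ∈? xs
    ... | yes x∈xs = x∈xs
    ... | no x∉xs  = contradiction (Any.map (λ { refl → x∉xs }) x∈) ¬any

  linearized : Tri → Carrier → Carrier
  linearized (a , b , c) x = a * x + b * fr x + c * fr (fr x)

  linearized-+ : ∀ ℓ x y → linearized ℓ (x + y) ≡ linearized ℓ x + linearized ℓ y
  linearized-+ (a , b , c) x y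
    rewrite fr-+ x y | fr-+ (fr x) (fr y) =
    solve 9 (λ a b c x y x′ y′ x″ y″ →
        a :* (x :+ y) :+ b :* (x′ :+ y′) :+ c :* (x″ :+ y″)
        := a :* x :+ b :* x′ :+ c :* x″ :+ (a :* y :+ b :* y′ :+ c :* y″))
      refl a b c x y (fr x) (fr y) (fr (fr x)) (fr (fr y))

  linearized-* : ∀ ℓ α x → InFq α → linearized ℓ (α * x) ≡ α * linearized ℓ x
  linearized-* (a , b , c) α x fα
    rewrite fr-* α x | fα | fr-* α (fr x) | fα =
    solve 7 (λ a b c α x x′ x″ →
        a :* (α :* x) :+ b :* (α :* x′) :+ c :* (α :* x″)
        := α :* (a :* x :+ b :* x′ :+ c :* x″))
      refl a b c α x (fr x) (fr (fr x))

  -- The last nonzero coefficient decides whether the degree is q², q or 1; in each case it is at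
  -- most q².
  linearized-roots-bound : ∀ ℓ → NZ ℓ → ∀ {xs} → Unique xs →
    (∀ {x} → x ∈ xs → linearized ℓ x ≡ 0#) → length xs ≤ q ℕ.* q
  linearized-roots-bound (a , b , c) nz {xs} u roots with c ≟ 0# | b ≟ 0# | a ≟ 0#
  ... | yes c≡0 | yes b≡0 | yes a≡0 = contradiction (a≡0 , b≡0 , c≡0) nz
  ... | yes refl | yes refl | no a≢0 =
    ℕ.≤-trans (roots-bound (a≢0 ∘ trans (sym (*-identityʳ a))) (Poly-scale a (Poly-pow 1)) u
      (λ {x} x∈ → trans (solve 4 (λ a x y z → a :* (x :* con 1) := a :* x :+ con 0 :* y :+ con 0 :* z)
        refl a x (fr x) (fr (fr x))) (roots x∈)))
      (ℕ.<⇒≤ (ℕ.<-trans 1<q q<q²))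
  ... | yes refl | no b≢0 | _ =
    ℕ.≤-trans (roots-bound (b≢0 ∘ trans (sym (*-identityʳ b)))
      (Poly-+-lower 1<q (Poly-scale b (Poly-pow q)) (Poly-scale a (Poly-pow 1))) u
      (λ {x} x∈ → trans (solve 5 (λ a b x y z → b :* y :+ a :* (x :* con 1) := a :* x :+ b :* y :+ con 0 :* z)
        refl a b x (fr x) (fr (fr x))) (roots x∈)))
      (ℕ.<⇒≤ q<q²)
  ... | no c≢0 | _ | _ =
    roots-bound (c≢0 ∘ trans (sym (*-identityʳ c)))
      (Poly-+-lower q<q² (Poly-scale c (Poly-pow (q ℕ.* q)))
        (Poly-+-lower 1<q (Poly-scale b (Poly-pow q)) (Poly-scale a (Poly-pow 1)))) u
      (λ {x} x∈ → trans (cong (λ w → c * w + (b * fr x + a * (x * 1#))) (pow-q² x))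
        (trans (solve 6 (λ a b c x y z → c :* z :+ (b :* y :+ a :* (x :* con 1)) := a :* x :+ b :* y :+ c :* z)
        refl a b c x (fr x) (fr (fr x))) (roots x∈)))

  linearized-nonroot : ∀ ℓ → NZ ℓ → ∃ λ x → ¬ (linearized ℓ x ≡ 0#)
  linearized-nonroot ℓ nz with any? (λ x → ¬? (linearized ℓ x ≟ 0#)) elements
  ... | yes any = Any.satisfied any
  ... | no ¬any = contradiction (linearized-roots-bound ℓ nz elements-unique root) (ℕ.<⇒≱ q²<card)
    where
    root : ∀ {x} → x ∈ elements → linearized ℓ x ≡ 0#
    root {x} x∈ with linearized ℓ x ≟ 0#
    ... | yes eq = eq
    ... | no neq = contradiction (Any.map (λ { refl → neq }) x∈) ¬any

  -- Norms and Hilbert's Theorem 90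

  norm : Carrier → Carrier
  norm x = x * fr x * fr (fr x)

  norm-* : ∀ x y → norm (x * y) ≡ norm x * norm y
  norm-* x y rewrite fr-* x y | fr-* (fr x) (fr y) =
    solve 6 (λ a b c d e f → a :* b :* (c :* d) :* (e :* f) := a :* c :* e :* (b :* d :* f))
      refl x y (fr x) (fr y) (fr (fr x)) (fr (fr y))

  norm-1 : norm 1# ≡ 1#
  norm-1 rewrite fr-1 | fr-1 = trans (cong (_* 1#) (*-identityˡ 1#)) (*-identityˡ 1#)

  norm-inverse : ∀ {x y} → x * y ≡ 1# → norm x ≡ 1# → norm y ≡ 1#
  norm-inverse {x} {y} xy≡1 Nx≡1 = begin
    norm y            ≡⟨ sym (*-identityˡ _) ⟩
    1# * norm y       ≡⟨ cong (_* norm y) (sym Nx≡1) ⟩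
    norm x * norm y   ≡⟨ sym (norm-* x y) ⟩
    norm (x * y)      ≡⟨ cong norm xy≡1 ⟩
    norm 1#           ≡⟨ norm-1 ⟩
    1#                ∎

  norm≡1⇒≢0 : ∀ {x} → norm x ≡ 1# → ¬ (x ≡ 0#)
  norm≡1⇒≢0 {x} Nx≡1 = *≡1⇒≢0 (trans (sym (*-assoc x (fr x) (fr (fr x)))) Nx≡1)

  -- With u = 1/e, any nonzero value h = θ + u θ^q + u^(1+q) θ^(q²) satisfies u h^q = h.
  hilbert90 : ∀ e → norm e ≡ 1# → ∃ λ h → ¬ (h ≡ 0#) × fr h ≡ e * h
  hilbert90 e Ne≡1 = value (linearized-nonroot (1# , u , u * fr u) (1≢0 ∘ proj₁))
    where
    u = proj₁ (inverse e (norm≡1⇒≢0 Ne≡1))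
    eu≡1 : e * u ≡ 1#
    eu≡1 = proj₂ (inverse e (norm≡1⇒≢0 Ne≡1))
    value : (∃ λ θ → ¬ (linearized (1# , u , u * fr u) θ ≡ 0#)) → ∃ λ h → ¬ (h ≡ 0#) × fr h ≡ e * h
    value (θ , h≢0) = h , h≢0 , fr-h
      where
      h = linearized (1# , u , u * fr u) θ
      u*fr-h : u * fr h ≡ h
      u*fr-h = begin
        u * fr h
          ≡⟨ cong (u *_) (trans (fr-+ _ _) (cong₂ _+_ (trans (fr-+ _ _) (cong₂ _+_
               (trans (fr-* 1# θ) (cong (_* fr θ) fr-1)) (fr-* u (fr θ))))
               (trans (fr-* (u * fr u) (fr (fr θ))) (cong₂ _*_ (fr-* u (fr u)) (fr³ θ))))) ⟩
        u * (1# * fr θ + fr u * fr (fr θ) + fr u * fr (fr u) * θ)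
          -- The last term returns to θ because the third power of Frobenius is the identity; its
          -- coefficient has become N(u), which is 1.
          ≡⟨ solve 6 (λ u u′ u″ θ θ′ θ″ → u :* (con 1 :* θ′ :+ u′ :* θ″ :+ u′ :* u″ :* θ)
               := u :* u′ :* u″ :* θ :+ u :* θ′ :+ u :* u′ :* θ″) refl u (fr u) (fr (fr u)) θ (fr θ) (fr (fr θ)) ⟩
        norm u * θ + u * fr θ + u * fr u * fr (fr θ)
          ≡⟨ cong (λ w → w * θ + u * fr θ + u * fr u * fr (fr θ)) (norm-inverse eu≡1 Ne≡1) ⟩
        1# * θ + u * fr θ + u * fr u * fr (fr θ) ∎
      fr-h : fr h ≡ e * h
      fr-h = begin
        fr h             ≡⟨ sym (*-identityˡ _) ⟩
        1# * fr h        ≡⟨ cong (_* fr h) (sym eu≡1) ⟩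
        e * u * fr h     ≡⟨ *-assoc e u _ ⟩
        e * (u * fr h)   ≡⟨ cong (e *_) u*fr-h ⟩
        e * h            ∎

  -- The sets π_λ as subplanes

  Independent : Carrier → Carrier → Set
  Independent x y = ¬ (x ≡ 0#) × (∀ α → InFq α → ¬ (y ≡ α * x))

  +-≡0 : ∀ {x y} → x + - y ≡ 0# → x ≡ y
  +-≡0 {x} {y} eq = +-cancelʳ (- y) x y (trans eq (sym (-‿inverseʳ y)))

  -- If β ≠ β′, then y = ((α′ - α)/(β - β′)) x is an F_q-multiple of x; if β = β′, cancelling x
  -- gives α = α′.
  independent⇒injective : ∀ {x y} → Independent x y → ∀ {α α′ β β′} →
    InFq α → InFq α′ → InFq β → InFq β′ → α * x + β * y ≡ α′ * x + β′ * y → α ≡ α′ × β ≡ β′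
  independent⇒injective {x} {y} (x≢0 , y∉) {α} {α′} {β} {β′} fα fα′ fβ fβ′ eq
    with (β + - β′) ≟ 0#
  ... | yes d≡0 = *-cancelʳ x≢0 (+-cancelʳ (β * y) _ _ (trans eq (cong (λ w → α′ * x + w * y) (sym β≡β′)))) , β≡β′
    where β≡β′ = +-≡0 d≡0
  ... | no d≢0 = contradiction y≡ (y∉ (d⁻¹ * e) (InFq-* (InFq-inverse dd⁻¹≡1 fd) fe))
    where
    d = β + - β′
    e = α′ + - α
    d⁻¹ = proj₁ (inverse d d≢0)
    dd⁻¹≡1 = proj₂ (inverse d d≢0)
    fd = InFq-+ fβ (InFq-neg fβ′)
    fe = InFq-+ fα′ (InFq-neg fα)
    dy≡ex : d * y ≡ e * x
    dy≡ex = begin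
      (β + - β′) * y
        ≡⟨ sym (+-identityˡ _) ⟩
      0# + (β + - β′) * y
        ≡⟨ cong (_+ (β + - β′) * y) (sym (trans (cong (_* x) (-‿inverseʳ α)) (zeroˡ x))) ⟩
      (α + - α) * x + (β + - β′) * y
        ≡⟨ solve 6 (λ a a- b b- x y → (a :+ a-) :* x :+ (b :+ b-) :* y := a :* x :+ b :* y :+ (a- :* x :+ b- :* y)) refl α (- α) β (- β′) x y ⟩
      α * x + β * y + (- α * x + - β′ * y)
        ≡⟨ cong (_+ (- α * x + - β′ * y)) eq ⟩
      α′ * x + β′ * y + (- α * x + - β′ * y)
        ≡⟨ solve 6 (λ a a- b b- x y → a :* x :+ b :* y :+ (a- :* x :+ b- :* y) := (a :+ a-) :* x :+ (b :+ b-) :* y) refl α′ (- α) β′ (- β′) x y ⟩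
      (α′ + - α) * x + (β′ + - β′) * y
        ≡⟨ cong ((α′ + - α) * x +_) (trans (cong (_* y) (-‿inverseʳ β′)) (zeroˡ y)) ⟩
      (α′ + - α) * x + 0#
        ≡⟨ +-identityʳ _ ⟩
      (α′ + - α) * x ∎
    y≡ : y ≡ d⁻¹ * e * x
    y≡ = *-cancelˡ d≢0 (trans dy≡ex (trans (sym (*-identityˡ _)) (trans (cong (_* (e * x)) (sym dd⁻¹≡1))
      (solve 4 (λ d i e x → d :* i :* (e :* x) := d :* (i :* e :* x)) refl d d⁻¹ e x))))

  span : Carrier → Carrier → List Carrier
  span x y = cartesianProductWith (λ α β → α * x + β * y) Fq Fq

  length-span : ∀ x y → length (span x y) ≡ q ℕ.* q
  length-span x y = trans (length-cartesianProductWith _ Fq Fq) (cong₂ ℕ._*_ length-Fq length-Fq)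

  ∈-span : ∀ {x y α β} → InFq α → InFq β → α * x + β * y ∈ span x y
  ∈-span fα fβ = ∈-cartesianProductWith⁺ _ (∈-Fq fα) (∈-Fq fβ)

  span-∋ : ∀ {x y z} → z ∈ span x y → ∃₂ λ α β → InFq α × InFq β × z ≡ α * x + β * y
  span-∋ z∈ with ∈-cartesianProductWith⁻ _ Fq Fq z∈
  ... | α , β , α∈ , β∈ , eq = α , β , Fq-InFq α∈ , Fq-InFq β∈ , eq

  span-unique : ∀ {x y} → Independent x y → Unique (span x y)
  span-unique ind = unique-cartesianProductWith _
    (λ α∈ α′∈ β∈ β′∈ → independent⇒injective ind (Fq-InFq α∈) (Fq-InFq α′∈) (Fq-InFq β∈) (Fq-InFq β′∈))
    Fq-unique Fq-unique

  span-roots : ∀ ℓ {x y} → linearized ℓ x ≡ 0# → linearized ℓ y ≡ 0# →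
    ∀ {z} → z ∈ span x y → linearized ℓ z ≡ 0#
  span-roots ℓ {x} {y} Lx≡0 Ly≡0 z∈ with span-∋ z∈
  ... | α , β , fα , fβ , refl = begin
    linearized ℓ (α * x + β * y)                  ≡⟨ linearized-+ ℓ _ _ ⟩
    linearized ℓ (α * x) + linearized ℓ (β * y)   ≡⟨ cong₂ _+_ (linearized-* ℓ α x fα) (linearized-* ℓ β y fβ) ⟩
    α * linearized ℓ x + β * linearized ℓ y       ≡⟨ cong₂ (λ u v → α * u + β * v) Lx≡0 Ly≡0 ⟩
    α * 0# + β * 0#                               ≡⟨ cong₂ _+_ (zeroʳ α) (zeroʳ β) ⟩
    0# + 0#                                       ≡⟨ +-identityʳ 0# ⟩
    0#                                            ∎

  -- The span already has q² elements, as many as ℓ can have roots.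
  roots-span : ∀ ℓ → NZ ℓ → ∀ {x y} → Independent x y → linearized ℓ x ≡ 0# → linearized ℓ y ≡ 0# →
    ∀ {z} → linearized ℓ z ≡ 0# → z ∈ span x y
  roots-span ℓ nz {x} {y} ind Lx≡0 Ly≡0 {z} Lz≡0 with z ∈? span x y
  ... | yes z∈ = z∈
  ... | no z∉  = contradiction
    (linearized-roots-bound ℓ nz {z ∷ span x y}
      (All.tabulate (λ { w∈ refl → z∉ w∈ }) ∷ span-unique ind)
      λ { (here refl) → Lz≡0 ; (there w∈) → span-roots ℓ Lx≡0 Ly≡0 w∈ })
    (ℕ.<⇒≱ (subst (λ n → q ℕ.* q < suc n) (sym (length-span x y)) (ℕ.n<1+n _)))

  -- If u + v = u′ + v′ with u, u′ roots of `ℓ` and v, v′ roots of `m`, then u - u′ = v′ - v is a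
  -- root of both. Without a nonzero common root, all q⁴ sums would therefore be distinct.
  common-root : ∀ ℓ m {x y x′ y′} → NZ ℓ → NZ m → Independent x y → Independent x′ y′ →
    linearized ℓ x ≡ 0# → linearized ℓ y ≡ 0# → linearized m x′ ≡ 0# → linearized m y′ ≡ 0# →
    ∃ λ z → ¬ (z ≡ 0#) × linearized ℓ z ≡ 0# × linearized m z ≡ 0#
  common-root ℓ m {x} {y} {x′} {y′} nzℓ nzm ind ind′ Lx Ly Mx′ My′
    with any? (λ z → ¬? (z ≟ 0#) ×-dec (linearized ℓ z ≟ 0#) ×-dec (linearized m z ≟ 0#)) elements
  ... | yes any = Any.satisfied any
  ... | no ¬any = contradiction (⊆⇒length≤ sums-unique (λ _ → elements-complete _)) (ℕ.<⇒≱ card<)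
    where
    sums : List Carrier
    sums = cartesianProductWith _+_ (span x y) (span x′ y′)
    inj : ∀ {u u′ v v′} → u ∈ span x y → u′ ∈ span x y → v ∈ span x′ y′ → v′ ∈ span x′ y′ →
      u + v ≡ u′ + v′ → u ≡ u′ × v ≡ v′
    inj {u} {u′} {v} {v′} u∈ u′∈ v∈ v′∈ eq with (u + - u′) ≟ 0#
    ... | yes d≡0 = +-≡0 d≡0 , +-cancelˡ u v v′ (trans eq (cong (_+ v′) (sym (+-≡0 d≡0))))
    ... | no d≢0 = contradiction
      (lose (elements-complete d) (d≢0 ,
        trans (sym (+-identityˡ _)) (trans (cong (_+ linearized ℓ d) (sym (span-roots ℓ Lx Ly u′∈)))
          (trans (sym (linearized-+ ℓ u′ d)) (trans (cong (linearized ℓ) u′+d≡u) (span-roots ℓ Lx Ly u∈)))) ,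
        trans (sym (+-identityʳ _)) (trans (cong (linearized m d +_) (sym (span-roots m Mx′ My′ v∈)))
          (trans (sym (linearized-+ m d v)) (trans (cong (linearized m) d+v≡v′) (span-roots m Mx′ My′ v′∈))))))
      ¬any
      where
      d = u + - u′
      u′+d≡u : u′ + d ≡ u
      u′+d≡u = trans (solve 3 (λ u u′ n → u′ :+ (u :+ n) := u :+ (u′ :+ n)) refl u u′ (- u′))
        (trans (cong (u +_) (-‿inverseʳ u′)) (+-identityʳ u))
      d+v≡v′ : d + v ≡ v′
      d+v≡v′ = +-cancelˡ u′ _ _ (trans (sym (+-assoc u′ d v)) (trans (cong (_+ v) u′+d≡u) eq))
    sums-unique : Unique sums
    sums-unique = unique-cartesianProductWith _+_ inj (span-unique ind) (span-unique ind′)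
    card< : card < length sums
    card< = subst₂ _<_ (sym (trans card≡q³ (cong (λ w → q ℕ.* (q ℕ.* w)) (ℕ.*-identityʳ q))))
      (sym (trans (length-cartesianProductWith _+_ (span x y) (span x′ y′))
        (cong₂ ℕ._*_ (length-span x y) (length-span x′ y′))))
      (subst (q ℕ.* (q ℕ.* q) <_) (sym (ℕ.*-assoc q q (q ℕ.* q)))
        (ℕ.*-monoʳ-< q (ℕ.*-monoʳ-< q q<q²)))

  -- Points of π_λ, their parameters, and incidence

  ∼-refl : ∀ r → r ∼ r
  ∼-refl (x , y , z) = 1# , 1≢0 , sym (cong₂ _,_ (*-identityˡ x) (cong₂ _,_ (*-identityˡ y) (*-identityˡ z)))

  ∼-sym : ∀ {r s} → r ∼ s → s ∼ r
  ∼-sym {r} {x , y , z} (c , c≢0 , refl) with inverse c c≢0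
  ... | d , cd≡1 = d , *≡1⇒≢0 (trans (*-comm d c) cd≡1) , cong₂ _,_ (eq x) (cong₂ _,_ (eq y) (eq z))
    where
    eq : ∀ w → w ≡ d * (c * w)
    eq w = trans (sym (*-identityˡ w)) (trans (cong (_* w) (sym cd≡1))
      (solve 3 (λ c d w → c :* d :* w := d :* (c :* w)) refl c d w))

  ∼-trans : ∀ {r s t} → r ∼ s → s ∼ t → r ∼ t
  ∼-trans {t = x , y , z} (c , c≢0 , refl) (d , d≢0 , refl) =
    c * d , *-≢0 c≢0 d≢0 , sym (cong₂ _,_ (*-assoc c d x) (cong₂ _,_ (*-assoc c d y) (*-assoc c d z)))

  On-∼ : ∀ ℓ {r s} → r ∼ s → On ℓ s → On ℓ r
  On-∼ (a , b , c) {s = x , y , z} (d , _ , refl) on = trans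
    (solve 7 (λ a b c d x y z → a :* (d :* x) :+ b :* (d :* y) :+ c :* (d :* z)
       := d :* (a :* x :+ b :* y :+ c :* z)) refl a b c d x y z)
    (trans (cong (d *_) on) (zeroʳ d))

  point : Carrier → Carrier → Tri
  point l x = x , fr x , l * fr (fr x)

  -- Moves the factor λ from the point to the line, so that incidence with the point of x says that
  -- x is a root of a linearized polynomial.
  twist : Carrier → Tri → Tri
  twist l (a , b , c) = a , b , c * l

  On⇒root : ∀ l ℓ {x} → On ℓ (point l x) → linearized (twist l ℓ) x ≡ 0#
  On⇒root l (a , b , c) {x} on = trans (cong (a * x + b * fr x +_) (*-assoc c l _)) on

  root⇒On : ∀ l ℓ {x} → linearized (twist l ℓ) x ≡ 0# → On ℓ (point l x)
  root⇒On l (a , b , c) {x} root = trans (cong (a * x + b * fr x +_) (sym (*-assoc c l _))) root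

  twist-NZ : ∀ {l} → ¬ (l ≡ 0#) → ∀ ℓ → NZ ℓ → NZ (twist l ℓ)
  twist-NZ {l} l≢0 (a , b , c) nz (a≡0 , b≡0 , cl≡0) with *-≡0 cl≡0
  ... | inj₁ c≡0 = nz (a≡0 , b≡0 , c≡0)
  ... | inj₂ l≡0 = l≢0 l≡0

  point-NZ : ∀ l {x} → ¬ (x ≡ 0#) → NZ (point l x)
  point-NZ l x≢0 (x≡0 , _) = x≢0 x≡0

  point∈π : ∀ l {x} → ¬ (x ≡ 0#) → π l (point l x)
  point∈π l x≢0 = _ , x≢0 , ∼-refl _

  point-∼⁺ : ∀ l {α x} → InFq α → ¬ (α ≡ 0#) → point l (α * x) ∼ point l x
  point-∼⁺ l {α} {x} fα α≢0 = α , α≢0 , cong (α * x ,_) (cong₂ _,_ fr-αx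
    (trans (cong (l *_) (trans (cong fr fr-αx) (trans (fr-* α (fr x)) (cong (_* fr (fr x)) fα))))
      (solve 3 (λ l a x → l :* (a :* x) := a :* (l :* x)) refl l α (fr (fr x)))))
    where
    fr-αx : fr (α * x) ≡ α * fr x
    fr-αx = trans (fr-* α x) (cong (_* fr x) fα)

  -- The first two coordinates give x = c y and x^q = c y^q. Hence c^q y^q = c y^q, which puts the
  -- factor c into F_q.
  point-∼⁻ : ∀ l {x y} → ¬ (y ≡ 0#) → point l x ∼ point l y → ∃ λ α → InFq α × ¬ (α ≡ 0#) × x ≡ α * y
  point-∼⁻ l {x} {y} y≢0 (c , c≢0 , eq) = c , *-cancelʳ (fr-≢0 y≢0) fr-c*fr-y , c≢0 , x≡cy
    where
    x≡cy = cong proj₁ eq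
    fr-c*fr-y : fr c * fr y ≡ c * fr y
    fr-c*fr-y = trans (sym (fr-* c y)) (trans (cong fr (sym x≡cy)) (cong (proj₁ ∘ proj₂) eq))

  1*+0* : ∀ x y → 1# * x + 0# * y ≡ x
  1*+0* x y = trans (cong₂ _+_ (*-identityˡ x) (zeroˡ y)) (+-identityʳ x)

  ¬∼⇒independent : ∀ l {r s x y} → ¬ (x ≡ 0#) → ¬ (y ≡ 0#) → r ∼ point l x → s ∼ point l y →
    ¬ (r ∼ s) → Independent x y
  ¬∼⇒independent l {x = x} x≢0 y≢0 r∼x s∼y r≁s = x≢0 , λ { α fα refl →
    r≁s (∼-trans r∼x (∼-trans (∼-sym (point-∼⁺ l fα (*≢0⇒≢0ˡ y≢0))) (∼-sym s∼y))) }

  module _ (l : Carrier) (l≢0 : ¬ (l ≡ 0#)) where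

    module _ {x y} (ind : Independent x y) where

      -- A projective line over F_q consists of x and of the q points α x + y. The coefficient `1#`
      -- is written out so that `combo α` is literally an element of `span x y`.
      combo : Carrier → Carrier
      combo α = α * x + 1# * y

      combo≢0 : ∀ {α} → InFq α → ¬ (combo α ≡ 0#)
      combo≢0 {α} fα eq = 1≢0 (proj₂ (independent⇒injective ind fα InFq-0 fr-1 InFq-0
        (trans eq (sym (trans (cong₂ _+_ (zeroˡ x) (zeroˡ y)) (+-identityʳ 0#))))))

      *-combo : ∀ c α → c * combo α ≡ c * α * x + c * y
      *-combo c α = solve 4 (λ c a x y → c :* (a :* x :+ con 1 :* y) := c :* a :* x :+ c :* y) refl c α x y

      x≁combo : ∀ {α} → InFq α → ¬ (point l x ∼ point l (combo α))
      x≁combo {α} fα x∼w =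
        let c , fc , c≢0 , eq = point-∼⁻ l (combo≢0 fα) x∼w in
        c≢0 (sym (proj₂ (independent⇒injective ind fr-1 (InFq-* fc fα) InFq-0 fc
          (trans (1*+0* x y) (trans eq (*-combo c α))))))

      combo≁combo : ∀ {α β} → InFq α → InFq β → ¬ (α ≡ β) → ¬ (point l (combo α) ∼ point l (combo β))
      combo≁combo {α} {β} fα fβ α≢β w∼w =
        let c , fc , c≢0 , eq = point-∼⁻ l (combo≢0 fβ) w∼w
            α≡cβ , 1≡c = independent⇒injective ind fα (InFq-* fc fβ) fr-1 fc (trans eq (*-combo c β))
        in α≢β (trans α≡cβ (trans (cong (_* β) (sym 1≡c)) (*-identityˡ β)))

      line-points : List Tri
      line-points = point l x ∷ map (λ α → point l (combo α)) Fq

      -- For z = α x + β y, the point of z is that of x if β = 0, and otherwise that of (α/β) x + y.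
      line-points-exhaustive : ∀ {r z} → r ∼ point l z → ¬ (z ≡ 0#) → z ∈ span x y → Any (r ∼_) line-points
      line-points-exhaustive {r} {z} r∼z z≢0 z∈ with span-∋ z∈
      ... | α , β , fα , fβ , z≡ with β ≟ 0#
      ...   | yes refl = here (∼-trans r∼z (subst (λ z → point l z ∼ point l x) (sym z≡αx)
                (point-∼⁺ l fα (λ α≡0 → z≢0 (trans z≡αx (trans (cong (_* x) α≡0) (zeroˡ x)))))))
        where
        z≡αx : z ≡ α * x
        z≡αx = trans z≡ (trans (cong (α * x +_) (zeroˡ y)) (+-identityʳ _))
      ...   | no β≢0 = there (Any.map⁺ (lose (∈-Fq fγ)
                (∼-trans r∼z (subst (λ z → point l z ∼ point l (combo γ)) (sym z≡βw) (point-∼⁺ l fβ β≢0)))))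
        where
        β⁻¹ = proj₁ (inverse β β≢0)
        ββ⁻¹≡1 = proj₂ (inverse β β≢0)
        γ = β⁻¹ * α
        fγ : InFq γ
        fγ = InFq-* (InFq-inverse ββ⁻¹≡1 fβ) fα
        z≡βw : z ≡ β * combo γ
        z≡βw = trans z≡ (trans (cong (λ t → t * x + β * y) (trans (sym (*-identityˡ α))
          (trans (cong (_* α) (sym ββ⁻¹≡1)) (*-assoc β β⁻¹ α)))) (sym (*-combo β γ)))

      line-meets : ∀ ℓ → NZ ℓ → On ℓ (point l x) → On ℓ (point l y) → MeetsIn (suc q) (π l) ℓ
      line-meets ℓ nz on-x on-y =
        line-points ,
        cong suc (trans (length-map _ Fq) length-Fq) ,
        (point-NZ l (proj₁ ind) , point∈π l (proj₁ ind) , on-x) ∷ All.map⁺ (All.tabulate λ α∈ →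
          point-NZ l (combo≢0 (Fq-InFq α∈)) , point∈π l (combo≢0 (Fq-InFq α∈)) , root⇒On l ℓ (combo-root (Fq-InFq α∈))) ,
        All.map⁺ (All.tabulate λ α∈ → x≁combo (Fq-InFq α∈)) ∷
          AllPairs.map⁺ (unique⇒allPairs (λ α∈ β∈ → combo≁combo (Fq-InFq α∈) (Fq-InFq β∈)) Fq-unique) ,
        λ r nzr (z , z≢0 , r∼z) on-r → line-points-exhaustive r∼z z≢0
          (roots-span (twist l ℓ) (twist-NZ l≢0 ℓ nz) ind
            (On⇒root l ℓ on-x) (On⇒root l ℓ on-y) (On⇒root l ℓ (On-∼ ℓ (∼-sym r∼z) on-r)))
        where
        combo-root : ∀ {α} → InFq α → linearized (twist l ℓ) (combo α) ≡ 0#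
        combo-root fα = span-roots (twist l ℓ) (On⇒root l ℓ on-x) (On⇒root l ℓ on-y) (∈-span fα fr-1)

    two-points : ∀ ℓ → SLine (π l) ℓ →
      ∃₂ λ x y → Independent x y × On ℓ (point l x) × On ℓ (point l y)
    two-points ℓ (_ , [] , len , _) = contradiction len (λ ())
    two-points ℓ (_ , r ∷ [] , len , _) =
      contradiction (subst (1 <_) (sym (ℕ.suc-injective len)) 1<q) (λ ())
    two-points ℓ (_ , r ∷ s ∷ _ , _ ,
        (_ , (x , x≢0 , r∼x) , on-r) ∷ (_ , (y , y≢0 , s∼y) , on-s) ∷ _ ,
        (r≁s ∷ _) ∷ _ , _) =
      x , y , ¬∼⇒independent l x≢0 y≢0 r∼x s∼y r≁s , On-∼ ℓ (∼-sym r∼x) on-r , On-∼ ℓ (∼-sym s∼y) on-s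

    fresh-independent : ∃ λ y → Independent 1# y
    fresh-independent =
      -- The factors `1#` match the multiples `α * x` of `Independent` at x = 1; there are q of them
      -- among q³ elements.
      let y , y∉ = fresh (map (_* 1#) Fq)
            (subst (_< card) (sym (trans (length-map _ Fq) length-Fq)) (ℕ.<-trans q<q² q²<card))
      in y , 1≢0 , λ α fα y≡α → y∉ (subst (_∈ map (_* 1#) Fq) (sym y≡α) (∈-map⁺ (_* 1#) (∈-Fq fα)))

    ¬collinear : ∀ {x y z} → Independent x y → z ∉ span x y →
      ¬ Collinear (point l x) (point l y) (point l z)
    ¬collinear ind z∉ (ℓ , nz , on-x , on-y , on-z) = z∉ (roots-span (twist l ℓ) (twist-NZ l≢0 ℓ nz) ind
      (On⇒root l ℓ on-x) (On⇒root l ℓ on-y) (On⇒root l ℓ on-z))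

    linearized-+₃ : ∀ ℓ x y z →
      linearized ℓ (x + y + z) ≡ linearized ℓ x + linearized ℓ y + linearized ℓ z
    linearized-+₃ ℓ x y z = trans (linearized-+ ℓ (x + y) z) (cong (_+ linearized ℓ z) (linearized-+ ℓ x y))

    0+0+x : ∀ {a b c d} → d ≡ a + b + c → d ≡ 0# → a ≡ 0# → b ≡ 0# → c ≡ 0#
    0+0+x {c = c} eq d≡0 refl refl = trans (sym (trans (cong (_+ c) (+-identityʳ 0#)) (+-identityˡ c)))
      (trans (sym eq) d≡0)

    Quadrangle : Set
    Quadrangle = ∃₂ λ a b → ∃₂ λ c d →
      (NZ a × NZ b × NZ c × NZ d) × (π l a × π l b × π l c × π l d)
      × ¬ Collinear a b c × ¬ Collinear a b d × ¬ Collinear a c d × ¬ Collinear b c d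

    -- The fourth point is that of t = 1 + y + z. By additivity, a line through it and two of the
    -- other three points also passes through the third, so one non-collinear triple yields all
    -- four.
    quadrangle : ∀ {y z} → Independent 1# y → z ∉ span 1# y → Quadrangle
    quadrangle {y} {z} ind z∉ =
      point l 1# , point l y , point l z , point l t ,
      (point-NZ l 1≢0 , point-NZ l y≢0 , point-NZ l z≢0 , point-NZ l t≢0) ,
      (point∈π l 1≢0 , point∈π l y≢0 , point∈π l z≢0 , point∈π l t≢0) ,
      xyz ,
      (λ (ℓ , nz , on-x , on-y , on-t) → xyz (ℓ , nz , on-x , on-y ,
        root⇒On l ℓ (0+0+x (linearized-+₃ (twist l ℓ) 1# y z)
          (On⇒root l ℓ on-t) (On⇒root l ℓ on-x) (On⇒root l ℓ on-y)))) ,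
      (λ (ℓ , nz , on-x , on-z , on-t) → xyz (ℓ , nz , on-x ,
        root⇒On l ℓ (0+0+x (trans (linearized-+₃ (twist l ℓ) 1# y z) (rot₁ _ _ _))
          (On⇒root l ℓ on-t) (On⇒root l ℓ on-x) (On⇒root l ℓ on-z)) , on-z)) ,
      (λ (ℓ , nz , on-y , on-z , on-t) → xyz (ℓ , nz ,
        root⇒On l ℓ (0+0+x (trans (linearized-+₃ (twist l ℓ) 1# y z) (rot₂ _ _ _))
          (On⇒root l ℓ on-t) (On⇒root l ℓ on-y) (On⇒root l ℓ on-z)) , on-y , on-z))
      where
      t = 1# + y + z
      rot₁ : ∀ a b c → a + b + c ≡ a + c + b
      rot₁ = solve 3 (λ a b c → a :+ b :+ c := a :+ c :+ b) refl
      rot₂ : ∀ a b c → a + b + c ≡ b + c + a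
      rot₂ = solve 3 (λ a b c → a :+ b :+ c := b :+ c :+ a) refl
      y≢0 : ¬ (y ≡ 0#)
      y≢0 y≡0 = proj₂ ind 0# InFq-0 (trans y≡0 (sym (zeroˡ 1#)))
      z≢0 : ¬ (z ≡ 0#)
      z≢0 z≡0 = z∉ (subst (_∈ span 1# y) (trans (cong₂ _+_ (zeroˡ 1#) (zeroˡ y)) (trans (+-identityʳ 0#) (sym z≡0)))
        (∈-span InFq-0 InFq-0))
      t≢0 : ¬ (t ≡ 0#)
      t≢0 t≡0 = z∉ (subst (_∈ span 1# y) -1-y≡z (∈-span f-1 f-1))
        where
        f-1 = InFq-neg fr-1
        -1-y≡z : - 1# * 1# + - 1# * y ≡ z
        -1-y≡z = +-cancelˡ (1# + y) _ _ (trans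
          (solve 2 (λ n y → con 1 :+ y :+ (n :* con 1 :+ n :* y) := (con 1 :+ n) :* (con 1 :+ y)) refl (- 1#) y)
          (trans (cong (_* (1# + y)) (-‿inverseʳ 1#)) (trans (zeroˡ _) (sym t≡0))))
      xyz : ¬ Collinear (point l 1#) (point l y) (point l z)
      xyz = ¬collinear ind z∉

    π-isFqPlane : IsFqPlane (π l)
    π-isFqPlane = lines , meets , quad
      where
      lines : ∀ r s ℓ → NZ r → NZ s → π l r → π l s → ¬ (r ∼ s) → NZ ℓ → On ℓ r → On ℓ s →
        MeetsIn (suc q) (π l) ℓ
      lines r s ℓ _ _ (x , x≢0 , r∼x) (y , y≢0 , s∼y) r≁s nz on-r on-s =
        line-meets (¬∼⇒independent l x≢0 y≢0 r∼x s∼y r≁s) ℓ nz (On-∼ ℓ (∼-sym r∼x) on-r) (On-∼ ℓ (∼-sym s∼y) on-s)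
      meets : ∀ ℓ m → SLine (π l) ℓ → SLine (π l) m → Σ Tri (λ r → NZ r × π l r × On ℓ r × On m r)
      meets ℓ m ℓ-line m-line with two-points ℓ ℓ-line | two-points m m-line
      ... | x , y , ind , on-x , on-y | x′ , y′ , ind′ , on-x′ , on-y′
        with common-root (twist l ℓ) (twist l m)
               (twist-NZ l≢0 ℓ (proj₁ ℓ-line)) (twist-NZ l≢0 m (proj₁ m-line)) ind ind′
               (On⇒root l ℓ on-x) (On⇒root l ℓ on-y) (On⇒root l m on-x′) (On⇒root l m on-y′)
      ...   | z , z≢0 , ℓz , mz = point l z , point-NZ l z≢0 , point∈π l z≢0 , root⇒On l ℓ ℓz , root⇒On l m mz
      quad : Quadrangle
      quad = let y , ind = fresh-independent
                 z , z∉ = fresh (span 1# y) (subst (_< card) (sym (length-span 1# y)) q²<card)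
             in quadrangle ind z∉

  -- Planes under equality of point sets

  SameSet-sym : ∀ {S T} → SameSet S T → SameSet T S
  SameSet-sym S≡T r = proj₂ (S≡T r) , proj₁ (S≡T r)

  MeetsIn-resp : ∀ {S T n} → SameSet S T → ∀ ℓ → MeetsIn n S ℓ → MeetsIn n T ℓ
  MeetsIn-resp S≡T ℓ (xs , len , all , pairs , exhaustive) =
    xs , len , All.map (λ (nz , s , on) → nz , proj₁ (S≡T _) s , on) all , pairs ,
    λ r nz t on → exhaustive r nz (proj₂ (S≡T r) t) on

  IsFqPlane-resp : ∀ {S T} → SameSet S T → IsFqPlane S → IsFqPlane T
  IsFqPlane-resp S≡T (lines , meets , a , b , c , d , nz , (Sa , Sb , Sc , Sd) , noncollinear) =
    (λ r s ℓ nzr nzs Tr Ts r≁s nzℓ on-r on-s →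
      MeetsIn-resp S≡T ℓ (lines r s ℓ nzr nzs (proj₂ (S≡T r) Tr) (proj₂ (S≡T s) Ts) r≁s nzℓ on-r on-s)) ,
    (λ ℓ m (nzℓ , ℓ-line) (nzm , m-line) →
      let r , nzr , Sr , on = meets ℓ m (nzℓ , MeetsIn-resp (SameSet-sym S≡T) ℓ ℓ-line)
                                        (nzm , MeetsIn-resp (SameSet-sym S≡T) m m-line)
      in r , nzr , proj₁ (S≡T r) Sr , on) ,
    a , b , c , d , nz ,
    (proj₁ (S≡T a) Sa , proj₁ (S≡T b) Sb , proj₁ (S≡T c) Sc , proj₁ (S≡T d) Sd) , noncollinear

  -- Cube roots of unity

  IsCubeRoot : Carrier → Set
  IsCubeRoot x = x * x * x ≡ 1#

  cubeRoot-≢0 : ∀ {x} → IsCubeRoot x → ¬ (x ≡ 0#)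
  cubeRoot-≢0 {x} x³≡1 = *≡1⇒≢0 (trans (sym (*-assoc x x x)) x³≡1)

  cubeRoot-² : ∀ {x} → IsCubeRoot x → IsCubeRoot (x * x)
  cubeRoot-² {x} x³≡1 = trans
    (solve 1 (λ x → x :* x :* (x :* x) :* (x :* x) := x :* x :* x :* (x :* x :* x)) refl x)
    (trans (cong₂ _*_ x³≡1 x³≡1) (*-identityˡ 1#))

  pow-3 : ∀ x → pow x 3 ≡ x * x * x
  pow-3 = solve 1 (λ x → x :* (x :* (x :* con 1)) := x :* x :* x) refl

  fr-cubeRoot : ∀ {x r m} → IsCubeRoot x → q ≡ r ℕ.+ m ℕ.* 3 → fr x ≡ pow x r
  fr-cubeRoot {x} {r} {m} x³≡1 q≡ = begin
    pow x q                      ≡⟨ cong (pow x) q≡ ⟩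
    pow x (r ℕ.+ m ℕ.* 3)        ≡⟨ pow-+ x r (m ℕ.* 3) ⟩
    pow x r * pow x (m ℕ.* 3)    ≡⟨ cong (pow x r *_) (pow-* x m 3) ⟩
    pow x r * pow (pow x 3) m    ≡⟨ cong (λ w → pow x r * pow w m) (trans (pow-3 x) x³≡1) ⟩
    pow x r * pow 1# m           ≡⟨ cong (pow x r *_) (pow-1# m) ⟩
    pow x r * 1#                 ≡⟨ *-identityʳ _ ⟩
    pow x r                      ∎

  -- If q is 1 modulo 3, then x^q = x at once. If q is 0, then x^q = 1 and N(x) = x. If q is 2, then
  -- x^q = x², so N(x) = x⁷ = x. In the last two cases x = 1.
  norm-1-cubeRoot : ∀ {x} → IsCubeRoot x → norm x ≡ 1# → InFq x
  norm-1-cubeRoot {x} x³≡1 Nx≡1 = by-residue (residue₃ q)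
    where
    by-residue : (∃₂ λ r m → q ≡ r ℕ.+ m ℕ.* 3 × (r ≡ 0 ⊎ r ≡ 1 ⊎ r ≡ 2)) → InFq x
    by-residue (_ , m , q≡ , inj₁ refl) = trans fx≡1 (sym x≡1)
      where
      fx≡1 : fr x ≡ 1#
      fx≡1 = fr-cubeRoot {m = m} x³≡1 q≡
      x≡1 : x ≡ 1#
      x≡1 = begin
        x                     ≡⟨ solve 1 (λ x → x := x :* con 1 :* con 1) refl x ⟩
        x * 1# * 1#           ≡⟨ sym (cong₂ (λ u v → x * u * v) fx≡1 (trans (cong fr fx≡1) fr-1)) ⟩
        norm x                ≡⟨ Nx≡1 ⟩
        1#                    ∎
    by-residue (_ , m , q≡ , inj₂ (inj₁ refl)) = trans (fr-cubeRoot {m = m} x³≡1 q≡) (*-identityʳ x)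
    by-residue (_ , m , q≡ , inj₂ (inj₂ refl)) = trans (cong fr x≡1) (trans fr-1 (sym x≡1))
      where
      fx≡xx : fr x ≡ x * x
      fx≡xx = trans (fr-cubeRoot {m = m} x³≡1 q≡) (cong (x *_) (*-identityʳ x))
      ffx : fr (fr x) ≡ x * x * (x * x)
      ffx = trans (cong fr fx≡xx) (trans (fr-* x x) (cong₂ _*_ fx≡xx fx≡xx))
      x≡1 : x ≡ 1#
      x≡1 = begin
        x                                       ≡⟨ solve 1 (λ x → x := con 1 :* con 1 :* x) refl x ⟩
        1# * 1# * x                             ≡⟨ sym (cong₂ (λ u v → u * v * x) x³≡1 x³≡1) ⟩
        x * x * x * (x * x * x) * x             ≡⟨ solve 1 (λ x → x :* x :* x :* (x :* x :* x) :* x := x :* (x :* x) :* (x :* x :* (x :* x))) refl x ⟩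
        x * (x * x) * (x * x * (x * x))         ≡⟨ sym (cong₂ (λ u v → x * u * v) fx≡xx ffx) ⟩
        norm x                                  ≡⟨ Nx≡1 ⟩
        1#                                      ∎

  module _ (3∤q-1 : ¬ (3 ∣ q ∸ 1)) where

    -- Membership in F_q means x = x^q, which is 1 or x² according as q is 0 or 2 modulo 3.
    only-cubeRoot : ∀ {x} → CubeRootFq x → x ≡ 1#
    only-cubeRoot {x} (fx , x³≡1) = by-residue (residue₃ q)
      where
      by-residue : (∃₂ λ r m → q ≡ r ℕ.+ m ℕ.* 3 × (r ≡ 0 ⊎ r ≡ 1 ⊎ r ≡ 2)) → x ≡ 1#
      by-residue (_ , m , q≡ , inj₁ refl) = trans (sym fx) (fr-cubeRoot {m = m} x³≡1 q≡)
      by-residue (_ , m , q≡ , inj₂ (inj₁ refl)) = contradiction (divides m (cong (_∸ 1) q≡)) 3∤q-1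
      by-residue (_ , m , q≡ , inj₂ (inj₂ refl)) = *-cancelˡ (cubeRoot-≢0 x³≡1)
        (trans (cong (x *_) (sym (*-identityʳ x))) (trans (sym (fr-cubeRoot {m = m} x³≡1 q≡))
          (trans fx (sym (*-identityʳ x)))))

  q≡suc : ∀ {m} → q ∸ 1 ≡ m → q ≡ suc m
  q≡suc q-1≡m = trans (sym (ℕ.suc-pred q)) (cong suc q-1≡m)

  module _ (3∣q-1 : 3 ∣ q ∸ 1) where

    q≡1+j*3 : ∃ λ j → q ≡ suc (j ℕ.* 3)
    q≡1+j*3 = _∣_.quotient 3∣q-1 , q≡suc (_∣_.equality 3∣q-1)

    cubeRoot-InFq : ∀ {x} → IsCubeRoot x → InFq x
    cubeRoot-InFq {x} x³≡1 =
      trans (fr-cubeRoot {m = proj₁ q≡1+j*3} x³≡1 (proj₂ q≡1+j*3)) (*-identityʳ x)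

    -- With q = 1 + 3j, the relation q·1 = 0 becomes 1 = 0 as soon as 3·1 = 0.
    3≢0 : ¬ (1# + (1# + 1#) ≡ 0#)
    3≢0 3≡0 = 1≢0 (begin
      1#                                ≡⟨ sym (+-identityʳ 1#) ⟩
      1# + 0#                           ≡⟨ cong (1# +_) (sym (trans (cong (j · 1# *_) 3·1≡0) (zeroʳ _))) ⟩
      1# + (j · 1#) * (3 · 1#)          ≡⟨ cong (1# +_) (sym (×1-homo-* j 3)) ⟩
      suc (j ℕ.* 3) · 1#                ≡⟨ cong (_· 1#) (sym (proj₂ q≡1+j*3)) ⟩
      q · 1#                            ≡⟨ q·1≡0 ⟩
      0#                                ∎)
      where
      j = proj₁ q≡1+j*3
      3·1≡0 : 3 · 1# ≡ 0#
      3·1≡0 = trans (cong (λ w → 1# + (1# + w)) (+-identityʳ 1#)) 3≡0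

    length-nonzeros-∣ : 3 ∣ length nonzeros
    -- The quotient comes from (1 + 3j)³ - 1 = 27j³ + 27j² + 9j.
    length-nonzeros-∣ = divides (9 ℕ.* (j ℕ.* j ℕ.* j) ℕ.+ 9 ℕ.* (j ℕ.* j) ℕ.+ 3 ℕ.* j)
      (ℕ.suc-injective (trans length-nonzeros (trans card≡q³ (trans (cong (_^ 3) (proj₂ q≡1+j*3))
        (ℕS.solve 1 (λ j →
          (ℕS.con 1 ℕS.:+ j ℕS.:* ℕS.con 3) ℕS.:* ((ℕS.con 1 ℕS.:+ j ℕS.:* ℕS.con 3) ℕS.:* ((ℕS.con 1 ℕS.:+ j ℕS.:* ℕS.con 3) ℕS.:* ℕS.con 1))
          ℕS.:= ℕS.con 1 ℕS.:+ (ℕS.con 9 ℕS.:* (j ℕS.:* j ℕS.:* j) ℕS.:+ ℕS.con 9 ℕS.:* (j ℕS.:* j) ℕS.:+ ℕS.con 3 ℕS.:* j) ℕS.:* ℕS.con 3)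
          refl j)))))
      where
      j = proj₁ q≡1+j*3
      module ℕS = ℕSolver.+-*-Solver

    -- x^((q³−1)/3) = 1 cannot hold for all q³−1 nonzero x.
    primitive-cubeRoot : ∀ M → length nonzeros ≡ M ℕ.* 3 → ∃ λ z → IsCubeRoot z × ¬ (z ≡ 1#)
    primitive-cubeRoot M len≡ with any? (λ x → ¬? (pow x M ≟ 1#) ×-dec (¬? (x ≟ 0#))) elements
    ... | yes any = let x , z≢1 , x≢0 = Any.satisfied any in
      pow x M , trans (sym (pow-3 _)) (trans (sym (pow-* x 3 M)) (trans
        (cong (pow x) (trans (ℕ.*-comm 3 M) (sym len≡))) (pow-length-nonzeros x≢0))) , z≢1
    ... | no ¬any = contradiction
      (roots-bound 1≢0 (Poly-+-lower 0<M (Poly-pow M) (const (λ _ → refl))) nonzeros-unique root)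
      (ℕ.<⇒≱ (subst (M <_) (sym len≡) (ℕ.m<m*n M 3 {{ℕ.>-nonZero 0<M}} (s≤s (s≤s z≤n)))))
      where
      root : ∀ {x} → x ∈ nonzeros → pow x M + - 1# ≡ 0#
      root {x} x∈ with pow x M ≟ 1#
      ... | yes eq = trans (cong (_+ - 1#) eq) (-‿inverseʳ 1#)
      ... | no neq = contradiction (lose (elements-complete x) (neq , nonzeros-≢0 x∈)) ¬any
      nonempty : ∀ {xs : List Carrier} {x} → x ∈ xs → 0 < length xs
      nonempty (here _)  = s≤s z≤n
      nonempty (there _) = s≤s z≤n
      0<M : 0 < M
      0<M = positive M len≡
        where
        positive : ∀ M → length nonzeros ≡ M ℕ.* 3 → 0 < M
        positive zero    eq = subst (0 <_) eq (nonempty (∈-nonzeros 1≢0))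
        positive (suc _) _  = s≤s z≤n

    module _ {z} (z³≡1 : IsCubeRoot z) (z≢1 : ¬ (z ≡ 1#)) where

      cubeRoots-unique : Unique (1# ∷ z ∷ z * z ∷ [])
      cubeRoots-unique = (z≢1 ∘ sym ∷ 1≢z² ∷ []) ∷ (z≢z² ∷ []) ∷ [] ∷ []
        where
        1≢z² : ¬ (1# ≡ z * z)
        1≢z² eq = z≢1 (trans (sym (*-identityˡ z)) (trans (cong (_* z) eq) z³≡1))
        z≢z² : ¬ (z ≡ z * z)
        z≢z² eq = z≢1 (sym (*-cancelˡ (cubeRoot-≢0 z³≡1) (trans (*-identityʳ z) eq)))

      cubeRoots-All : All IsCubeRoot (1# ∷ z ∷ z * z ∷ [])
      cubeRoots-All = trans (cong (_* 1#) (*-identityˡ 1#)) (*-identityˡ 1#) ∷ z³≡1 ∷ cubeRoot-² z³≡1 ∷ []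

      -- A further cube root of unity would be a fourth root of X³ - 1.
      cubeRoots-complete : ∀ {x} → IsCubeRoot x → x ∈ 1# ∷ z ∷ z * z ∷ []
      cubeRoots-complete {x} x³≡1 with x ∈? 1# ∷ z ∷ z * z ∷ []
      ... | yes x∈ = x∈
      ... | no x∉  = contradiction
        (roots-bound 1≢0 (Poly-+-lower (s≤s z≤n) (Poly-pow 3) (const (λ _ → refl)))
          (All.tabulate (λ { y∈ refl → x∉ y∈ }) ∷ cubeRoots-unique)
          λ {y} y∈ → trans (cong (_+ - 1#) (trans (pow-3 y) (All.lookup (x³≡1 ∷ cubeRoots-All) y∈))) (-‿inverseʳ 1#))
        (λ { (s≤s (s≤s (s≤s ()))) })

  CubeRootList : Set
  CubeRootList = Σ (List Carrier) (λ ls → Unique ls × length ls ≡ gcd 3 (q ∸ 1)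
    × All CubeRootFq ls × ((l : Carrier) → CubeRootFq l → l ∈ ls))

  three-cubeRoots : 3 ∣ q ∸ 1 → (∃ λ z → IsCubeRoot z × ¬ (z ≡ 1#)) → CubeRootList
  three-cubeRoots 3∣q-1 (z , z³≡1 , z≢1) =
    1# ∷ z ∷ z * z ∷ [] , cubeRoots-unique 3∣q-1 z³≡1 z≢1 , sym (gcd-∣ 3∣q-1) ,
    All.map (λ x³≡1 → cubeRoot-InFq 3∣q-1 x³≡1 , x³≡1) (cubeRoots-All 3∣q-1 z³≡1 z≢1) ,
    λ l (_ , l³≡1) → cubeRoots-complete 3∣q-1 z³≡1 z≢1 l³≡1

  one-cubeRoot : ¬ (3 ∣ q ∸ 1) → CubeRootList
  one-cubeRoot 3∤q-1 =
    1# ∷ [] , [] ∷ [] , sym (gcd₃-∤ 3∤q-1) ,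
    (fr-1 , trans (cong (_* 1#) (*-identityˡ 1#)) (*-identityˡ 1#)) ∷ [] ,
    λ l l-cube → here (only-cubeRoot 3∤q-1 l-cube)

  cubeRoots : CubeRootList
  cubeRoots with 3 ∣? q ∸ 1
  ... | yes 3∣q-1 = three-cubeRoots 3∣q-1 (primitive-cubeRoot 3∣q-1
    (_∣_.quotient (length-nonzeros-∣ 3∣q-1)) (_∣_.equality (length-nonzeros-∣ 3∣q-1)))
  ... | no 3∤q-1 = one-cubeRoot 3∤q-1

  norm-InFq : ∀ {x} → InFq x → norm x ≡ x * x * x
  norm-InFq {x} fx = cong₂ (λ u v → x * u * v) fx (trans (cong fr fx) fx)

  -- Orbits and φ

  ψ-∼ : ∀ t {r s} → r ∼ s → ψ t r ∼ ψ t s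
  ψ-∼ t {s = x , y , z} (c , c≢0 , refl) = c , c≢0 ,
    cong₂ _,_ (swap t x) (cong₂ _,_ (swap (fr t) y) (swap (fr (fr t)) z))
    where
    swap : ∀ t x → t * (c * x) ≡ c * (t * x)
    swap t x = solve 3 (λ t c x → t :* (c :* x) := c :* (t :* x)) refl t c x

  ψ-point : ∀ t l x → ψ t (point l x) ≡ point l (t * x)
  ψ-point t l x = cong (t * x ,_) (cong₂ _,_ (sym (fr-* t x))
    (trans (solve 3 (λ t l x → t :* (l :* x) := l :* (t :* x)) refl (fr (fr t)) l (fr (fr x)))
      (cong (l *_) (sym (trans (cong fr (fr-* t x)) (fr-* (fr t) (fr x)))))))

  -- The map `ψ t` multiplies the parameter of a point by t, and t = x/u carries the parameter u to
  -- any prescribed nonzero x.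
  orbit-π : ∀ l {p₀ u} → ¬ (u ≡ 0#) → p₀ ∼ point l u → SameSet (Orb p₀) (π l)
  orbit-π l {p₀} {u} u≢0 p₀∼u r = to , from
    where
    ψp₀∼ : ∀ t → ψ t p₀ ∼ point l (t * u)
    ψp₀∼ t = subst (ψ t p₀ ∼_) (ψ-point t l u) (ψ-∼ t p₀∼u)
    to : Orb p₀ r → π l r
    to (t , t≢0 , r∼) = t * u , *-≢0 t≢0 u≢0 , ∼-trans r∼ (ψp₀∼ t)
    from : π l r → Orb p₀ r
    from (x , x≢0 , r∼x) = x * v , *-≢0 x≢0 v≢0 ,
      ∼-trans r∼x (∼-sym (subst (λ y → ψ (x * v) p₀ ∼ point l y) xvu≡x (ψp₀∼ (x * v))))
      where
      v = proj₁ (inverse u u≢0)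
      uv≡1 = proj₂ (inverse u u≢0)
      v≢0 : ¬ (v ≡ 0#)
      v≢0 = *≡1⇒≢0 (trans (*-comm v u) uv≡1)
      xvu≡x : x * v * u ≡ x
      xvu≡x = trans (*-assoc x v u) (trans (cong (x *_) (trans (*-comm v u) uv≡1)) (*-identityʳ x))

  φ-∼ : ∀ {r s} → r ∼ s → φ r ∼ φ s
  φ-∼ {s = x , y , z} (c , c≢0 , refl) =
    fr c , fr-≢0 c≢0 , cong₂ _,_ (fr-* c z) (cong₂ _,_ (fr-* c x) (fr-* c y))

  φ³ : ∀ r → φ (φ (φ r)) ≡ r
  φ³ (x , y , z) = cong₂ _,_ (fr³ x) (cong₂ _,_ (fr³ y) (fr³ z))

  φ-point : ∀ {l} x → InFq l → φ (point l x) ≡ (l * x , fr x , fr (fr x))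
  φ-point {l} x fl = cong (_, fr x , fr (fr x)) (trans (fr-* l (fr (fr x))) (cong₂ _*_ fl (fr³ x)))

  φ²-point : ∀ {l} x → InFq l → φ (φ (point l x)) ≡ (x , l * fr x , fr (fr x))
  φ²-point {l} x fl = trans (cong φ (φ-point x fl))
    (cong₂ _,_ (fr³ x) (cong (_, fr (fr x)) (trans (fr-* l x) (cong (_* fr x) fl))))

  FixedByφ-resp : ∀ {S T} → SameSet S T → FixedByφ S → FixedByφ T
  FixedByφ-resp S≡T fixed r =
    (λ Tr → proj₁ (S≡T (φ r)) (proj₁ (fixed r) (proj₂ (S≡T r) Tr))) ,
    (λ Tφr → proj₁ (S≡T r) (proj₂ (fixed r) (proj₂ (S≡T (φ r)) Tφr)))

  -- φ sends the point of x to that of x v, where v^(q−1) = 1/l.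
  π-fixed : ∀ {l} → CubeRootFq l → FixedByφ (π l)
  π-fixed {l} (fl , l³≡1) r = φ∈ , λ φr∈ → subst (π l) (φ³ r) (φ∈ (φ∈ φr∈))
    where
    -- Here `l * l` is the inverse of `l`; since `l` lies in F_q, its norm is the cube l⁶ = 1.
    hilbert = hilbert90 (l * l) (trans (norm-InFq (InFq-* fl fl)) (cubeRoot-² l³≡1))
    v = proj₁ hilbert
    v≢0 = proj₁ (proj₂ hilbert)
    fv : fr v ≡ l * l * v
    fv = proj₂ (proj₂ hilbert)
    ffv : fr (fr v) ≡ l * l * (l * l * v)
    ffv = trans (cong fr fv) (trans (fr-* (l * l) v) (cong₂ _*_ (InFq-* fl fl) fv))
    w = proj₁ (inverse v v≢0)
    vw≡1 : v * w ≡ 1#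
    vw≡1 = proj₂ (inverse v v≢0)
    -- Inserting factors equal to 1, namely v w and copies of l³, turns each coordinate into a
    -- semiring identity.
    1*1*1 : ∀ {a b c} → a ≡ 1# → b ≡ 1# → c ≡ 1# → ∀ y → y ≡ a * b * c * y
    1*1*1 refl refl refl y = solve 1 (λ y → y := con 1 :* con 1 :* con 1 :* y) refl y
    φ-point∼ : ∀ x → φ (point l x) ∼ point l (x * v)
    -- The scalar l/v is dictated by the first coordinates, l x and x v.
    φ-point∼ x = l * w , *-≢0 (cubeRoot-≢0 l³≡1) (*≡1⇒≢0 (trans (*-comm w v) vw≡1)) ,
      trans (φ-point x fl) (cong₂ _,_
        (trans (1*1*1 vw≡1 refl refl (l * x))
          (solve 4 (λ l w x v → v :* w :* con 1 :* con 1 :* (l :* x) := l :* w :* (x :* v)) refl l w x v))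
        (cong₂ _,_
          (trans (1*1*1 vw≡1 l³≡1 refl (fr x)) (trans
            (solve 4 (λ l w x v → v :* w :* (l :* l :* l) :* con 1 :* x := l :* w :* (x :* (l :* l :* v))) refl l w (fr x) v)
            (cong (l * w *_) (sym (trans (fr-* x v) (cong (fr x *_) fv))))))
          (trans (1*1*1 vw≡1 l³≡1 l³≡1 (fr (fr x))) (trans
            (solve 4 (λ l w x v → v :* w :* (l :* l :* l) :* (l :* l :* l) :* x
               := l :* w :* (l :* (x :* (l :* l :* (l :* l :* v))))) refl l w (fr (fr x)) v)
            (cong (λ y → l * w * (l * y)) (sym (trans (cong fr (fr-* x v))
              (trans (fr-* (fr x) (fr v)) (cong (fr (fr x) *_) ffv)))))))))
    φ∈ : ∀ {r} → π l r → π l (φ r)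
    φ∈ (x , x≢0 , r∼x) = x * v , *-≢0 x≢0 v≢0 , ∼-trans (φ-∼ r∼x) (φ-point∼ x)

  fr-point1 : ∀ l → point l 1# ≡ (1# , 1# , l)
  fr-point1 l = cong (1# ,_) (cong₂ _,_ fr-1 (trans (cong (l *_) (trans (cong fr fr-1) fr-1)) (*-identityʳ l)))

  -- The point (1, 1, λ) is tested. Its first two coordinates force the parameter x in the other set
  -- into F_q with c x = 1, and then the third coordinates agree.
  π-injective : ∀ {l m} → SameSet (π l) (π m) → l ≡ m
  π-injective {l} {m} πl≡πm =
    let x , x≢0 , c , c≢0 , eq = proj₁ (πl≡πm (1# , 1# , l))
          (subst (π l) (fr-point1 l) (point∈π l 1≢0))
        1≡cx = cong proj₁ eq
        fx≡x : fr x ≡ x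
        fx≡x = *-cancelˡ c≢0 (trans (sym (cong (proj₁ ∘ proj₂) eq)) 1≡cx)
    in begin
      l                      ≡⟨ cong (proj₂ ∘ proj₂) eq ⟩
      c * (m * fr (fr x))    ≡⟨ cong (λ y → c * (m * y)) (trans (cong fr fx≡x) fx≡x) ⟩
      c * (m * x)            ≡⟨ solve 3 (λ c m x → c :* (m :* x) := m :* (c :* x)) refl c m x ⟩
      m * (c * x)            ≡⟨ cong (m *_) (sym 1≡cx) ⟩
      m * 1#                 ≡⟨ *-identityʳ m ⟩
      m                      ∎

  -- If φ r = c r, then φ³ = 1 gives N(c) = 1. With h^(q-1) = c, the vector r/h is fixed by φ
  -- coordinate by coordinate, hence of the form (u, u^q, u^(q²)) with u = x/h.
  π₁≡P2q : SameSet (π 1#) P2q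
  π₁≡P2q r@(x , y , z) = to , from
    where
    φ-point₁ : ∀ u → φ (point 1# u) ≡ point 1# u
    φ-point₁ u = trans (φ-point u fr-1) (cong₂ _,_ (*-identityˡ u) (cong (fr u ,_) (sym (*-identityˡ _))))
    to : π 1# r → P2q r
    to (u , u≢0 , r∼u) =
      (λ (x≡0 , _) → let c , c≢0 , eq = r∼u in *-≢0 c≢0 u≢0 (trans (sym (cong proj₁ eq)) x≡0)) ,
      ∼-trans (subst (φ r ∼_) (φ-point₁ u) (φ-∼ r∼u)) (∼-sym r∼u)
    from : P2q r → π 1# r
    from (nz , c , c≢0 , eq) = x * v , *-≢0 x≢0 (*≡1⇒≢0 (trans (*-comm v h) hv≡1)) , h , h≢0 ,
      cong₂ _,_ x≡ (cong₂ _,_ y≡ z≡)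
      where
      fz≡cx = cong proj₁ eq
      fx≡cy = cong (proj₁ ∘ proj₂) eq
      fy≡cz = cong (proj₂ ∘ proj₂) eq
      x≢0 : ¬ (x ≡ 0#)
      x≢0 x≡0 = nz (x≡0 , y≡0 , next y≡0 fy≡cz)
        where
        next : ∀ {a b} → a ≡ 0# → fr a ≡ c * b → b ≡ 0#
        next {b = b} refl fa≡cb = *-cancelˡ c≢0 (trans (sym fa≡cb) (trans fr-0 (sym (zeroʳ c))))
        y≡0 = next x≡0 fx≡cy
      ffx : fr (fr x) ≡ fr c * (c * z)
      ffx = trans (cong fr fx≡cy) (trans (fr-* c y) (cong (fr c *_) fy≡cz))
      Nc≡1 : norm c ≡ 1#
      Nc≡1 = *-cancelʳ x≢0 (begin
        c * fr c * fr (fr c) * x         ≡⟨ solve 4 (λ c c′ c″ x → c :* c′ :* c″ :* x := c″ :* (c′ :* (c :* x))) refl c (fr c) (fr (fr c)) x ⟩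
        fr (fr c) * (fr c * (c * x))     ≡⟨ cong (λ w → fr (fr c) * (fr c * w)) (sym fz≡cx) ⟩
        fr (fr c) * (fr c * fr z)        ≡⟨ cong (fr (fr c) *_) (sym (fr-* c z)) ⟩
        fr (fr c) * fr (c * z)           ≡⟨ sym (fr-* (fr c) (c * z)) ⟩
        fr (fr c * (c * z))              ≡⟨ cong fr (sym ffx) ⟩
        fr (fr (fr x))                   ≡⟨ fr³ x ⟩
        x                                ≡⟨ sym (*-identityˡ x) ⟩
        1# * x                           ∎)
      hilbert = hilbert90 c Nc≡1
      h = proj₁ hilbert
      h≢0 = proj₁ (proj₂ hilbert)
      fh : fr h ≡ c * h
      fh = proj₂ (proj₂ hilbert)
      v = proj₁ (inverse h h≢0)
      hv≡1 : h * v ≡ 1#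
      hv≡1 = proj₂ (inverse h h≢0)
      x≡ : x ≡ h * (x * v)
      x≡ = trans (sym (*-identityʳ x)) (trans (cong (x *_) (sym hv≡1))
        (solve 3 (λ x h v → x :* (h :* v) := h :* (x :* v)) refl x h v))
      y≡ : y ≡ h * fr (x * v)
      y≡ = begin
        y                      ≡⟨ sym (*-identityʳ y) ⟩
        y * 1#                 ≡⟨ cong (y *_) (sym (fr-inverse hv≡1)) ⟩
        y * (fr h * fr v)      ≡⟨ cong (λ w → y * (w * fr v)) fh ⟩
        y * (c * h * fr v)     ≡⟨ solve 4 (λ y c h v → y :* (c :* h :* v) := h :* (c :* y :* v)) refl y c h (fr v) ⟩
        h * (c * y * fr v)     ≡⟨ cong (λ w → h * (w * fr v)) (sym fx≡cy) ⟩
        h * (fr x * fr v)      ≡⟨ cong (h *_) (sym (fr-* x v)) ⟩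
        h * fr (x * v)         ∎
      z≡ : z ≡ h * (1# * fr (fr (x * v)))
      z≡ = begin
        z                                        ≡⟨ sym (*-identityʳ z) ⟩
        z * 1#                                   ≡⟨ cong (z *_) (sym (fr-inverse (fr-inverse hv≡1))) ⟩
        z * (fr (fr h) * fr (fr v))              ≡⟨ cong (λ w → z * (w * fr (fr v))) (trans (cong fr fh) (trans (fr-* c h) (cong (fr c *_) fh))) ⟩
        z * (fr c * (c * h) * fr (fr v))         ≡⟨ solve 5 (λ z c c′ h v → z :* (c′ :* (c :* h) :* v) := h :* (con 1 :* (c′ :* (c :* z) :* v))) refl z c (fr c) h (fr (fr v)) ⟩
        h * (1# * (fr c * (c * z) * fr (fr v)))  ≡⟨ cong (λ w → h * (1# * (w * fr (fr v)))) (sym ffx) ⟩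
        h * (1# * (fr (fr x) * fr (fr v)))       ≡⟨ cong (λ w → h * (1# * w)) (sym (trans (cong fr (fr-* x v)) (fr-* (fr x) (fr v)))) ⟩
        h * (1# * fr (fr (x * v)))               ∎

  -- The maps `ψ t` are diagonal, so the orbit of a point with first coordinate 0 stays on the line
  -- [1, 0, 0].
  orbit-¬collinear⇒≢0 : ∀ {a b c r s t} → Orb (a , b , c) r → Orb (a , b , c) s → Orb (a , b , c) t →
    ¬ Collinear r s t → ¬ (a ≡ 0#)
  orbit-¬collinear⇒≢0 r∈ s∈ t∈ ¬col refl =
    ¬col ((1# , 0# , 0#) , 1≢0 ∘ proj₁ , on-x=0 r∈ , on-x=0 s∈ , on-x=0 t∈)
    where
    on-x=0 : ∀ {b c r} → Orb (0# , b , c) r → On (1# , 0# , 0#) r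
    on-x=0 (t , _ , d , _ , refl) =
      solve 4 (λ d t y z → con 1 :* (d :* (t :* con 0)) :+ con 0 :* y :+ con 0 :* z := con 0) refl d t _ _

  orbit-self : ∀ p₀ → Orb p₀ p₀
  orbit-self (a , b , c) = 1# , 1≢0 , 1# , 1≢0 ,
    cong₂ _,_ (1*1* refl a) (cong₂ _,_ (1*1* fr-1 b) (1*1* (trans (cong fr fr-1) fr-1) c))
    where
    1*1* : ∀ {t} → t ≡ 1# → ∀ x → x ≡ 1# * (t * x)
    1*1* refl x = solve 1 (λ x → x := con 1 :* (con 1 :* x)) refl x

  -- If φ p₀ = s ψ_t p₀, then N(s) t³ = 1.  Hence ω = t^(q−1) is a cube root of unity, lies in F_q,
  -- and N(s t^q) = 1; Hilbert 90 for s t^q provides the representative of p₀.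
  module _ {a b c s t} (a≢0 : ¬ (a ≡ 0#)) (s≢0 : ¬ (s ≡ 0#)) (t≢0 : ¬ (t ≡ 0#))
           (fc≡ : fr c ≡ s * (t * a)) (fa≡ : fr a ≡ s * (fr t * b)) (fb≡ : fr b ≡ s * (fr (fr t) * c)) where

    ffa≡ : fr (fr a) ≡ fr s * (fr (fr t) * (s * (fr (fr t) * c)))
    ffa≡ = trans (cong fr fa≡) (trans (fr-* s _) (cong (fr s *_)
      (trans (fr-* (fr t) b) (cong (fr (fr t) *_) fb≡))))

    -- The relation φ³ = 1 read on the first coordinate: one more Frobenius turns `ffa≡` back into
    -- a, and each of the three steps has contributed a conjugate of s and one factor t.
    norm-s*t³ : norm s * (t * t * t) ≡ 1#
    norm-s*t³ = *-cancelʳ a≢0 (begin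
      s * fr s * fr (fr s) * (t * t * t) * a
        ≡⟨ solve 5 (λ s s′ s″ t a → s :* s′ :* s″ :* (t :* t :* t) :* a := s″ :* (t :* (s′ :* (t :* (s :* (t :* a)))))) refl s (fr s) (fr (fr s)) t a ⟩
      fr (fr s) * (t * (fr s * (t * (s * (t * a)))))
        ≡⟨ cong₂ (λ u w → fr (fr s) * (u * (fr s * (u * w)))) (sym (fr³ t)) (sym fc≡) ⟩
      fr (fr s) * (fr (fr (fr t)) * (fr s * (fr (fr (fr t)) * fr c)))
        ≡⟨ sym (trans (fr-* (fr s) _) (cong (fr (fr s) *_) (trans (fr-* (fr (fr t)) _)
             (cong (fr (fr (fr t)) *_) (trans (fr-* s _) (cong (fr s *_) (fr-* (fr (fr t)) c))))))) ⟩
      fr (fr s * (fr (fr t) * (s * (fr (fr t) * c))))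
        ≡⟨ cong fr (sym ffa≡) ⟩
      fr (fr (fr a))
        ≡⟨ fr³ a ⟩
      a
        ≡⟨ sym (*-identityˡ a) ⟩
      1# * a ∎)

    t⁻¹ ω : Carrier
    t⁻¹ = proj₁ (inverse t t≢0)
    ω = fr t * t⁻¹

    tt⁻¹≡1 : t * t⁻¹ ≡ 1#
    tt⁻¹≡1 = proj₂ (inverse t t≢0)

    ft≡ωt : fr t ≡ ω * t
    ft≡ωt = trans (sym (*-identityʳ (fr t))) (trans (cong (fr t *_) (sym tt⁻¹≡1))
      (solve 3 (λ f t i → f :* (t :* i) := f :* i :* t) refl (fr t) t t⁻¹))

    norm-fr : ∀ x → norm (fr x) ≡ norm x
    norm-fr x = trans (cong (fr x * fr (fr x) *_) (fr³ x))
      (solve 3 (λ x y z → y :* z :* x := x :* y :* z) refl x (fr x) (fr (fr x)))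

    fr-norm : ∀ x → fr (norm x) ≡ norm x
    fr-norm x = trans (trans (fr-* _ _) (cong (_* fr (fr (fr x))) (fr-* x (fr x)))) (norm-fr x)

    -- N(s) is fixed by Frobenius, so its inverse t³ is fixed too; this makes ω a cube root of
    -- unity.
    fr-t³ : fr t * fr t * fr t ≡ t * t * t
    fr-t³ = *-cancelˡ (*≡1⇒≢0 norm-s*t³) (begin
      norm s * (fr t * fr t * fr t)        ≡⟨ cong₂ _*_ (sym (fr-norm s)) (sym (trans (fr-* (t * t) t) (cong (_* fr t) (fr-* t t)))) ⟩
      fr (norm s) * fr (t * t * t)         ≡⟨ sym (fr-* (norm s) (t * t * t)) ⟩
      fr (norm s * (t * t * t))            ≡⟨ cong fr norm-s*t³ ⟩
      fr 1#                                ≡⟨ fr-1 ⟩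
      1#                                   ≡⟨ sym norm-s*t³ ⟩
      norm s * (t * t * t)                 ∎)

    ω³≡1 : IsCubeRoot ω
    ω³≡1 = begin
      ω * ω * ω                                          ≡⟨ solve 2 (λ f i → f :* i :* (f :* i) :* (f :* i) := f :* f :* f :* (i :* i :* i)) refl (fr t) t⁻¹ ⟩
      fr t * fr t * fr t * (t⁻¹ * t⁻¹ * t⁻¹)             ≡⟨ cong (_* (t⁻¹ * t⁻¹ * t⁻¹)) fr-t³ ⟩
      t * t * t * (t⁻¹ * t⁻¹ * t⁻¹)                      ≡⟨ solve 2 (λ t i → t :* t :* t :* (i :* i :* i) := t :* i :* (t :* i) :* (t :* i)) refl t t⁻¹ ⟩
      t * t⁻¹ * (t * t⁻¹) * (t * t⁻¹)                    ≡⟨ cong (λ w → w * w * w) tt⁻¹≡1 ⟩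
      1# * 1# * 1#                                       ≡⟨ trans (cong (_* 1#) (*-identityˡ 1#)) (*-identityˡ 1#) ⟩
      1#                                                 ∎

    fω : InFq ω
    fω = norm-1-cubeRoot ω³≡1 (begin
      norm (fr t * t⁻¹)         ≡⟨ norm-* (fr t) t⁻¹ ⟩
      norm (fr t) * norm t⁻¹    ≡⟨ cong (_* norm t⁻¹) (norm-fr t) ⟩
      norm t * norm t⁻¹         ≡⟨ sym (norm-* t t⁻¹) ⟩
      norm (t * t⁻¹)            ≡⟨ cong norm tt⁻¹≡1 ⟩
      norm 1#                   ≡⟨ norm-1 ⟩
      1#                        ∎)

    fft≡ω*ft : fr (fr t) ≡ ω * fr t
    fft≡ω*ft = trans (cong fr ft≡ωt) (trans (fr-* ω t) (cong (_* fr t) fω))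

    norm-t : norm t ≡ t * t * t
    norm-t = begin
      t * fr t * fr (fr t)           ≡⟨ cong₂ (λ u v → t * u * v) ft≡ωt (trans fft≡ω*ft (cong (ω *_) ft≡ωt)) ⟩
      t * (ω * t) * (ω * (ω * t))    ≡⟨ solve 2 (λ w t → t :* (w :* t) :* (w :* (w :* t)) := w :* w :* w :* (t :* t :* t)) refl ω t ⟩
      ω * ω * ω * (t * t * t)        ≡⟨ cong (_* (t * t * t)) ω³≡1 ⟩
      1# * (t * t * t)               ≡⟨ *-identityˡ _ ⟩
      t * t * t                      ∎

    norm-st^q : norm (s * fr t) ≡ 1#
    norm-st^q = trans (norm-* s (fr t)) (trans (cong (norm s *_) (trans (norm-fr t) norm-t)) norm-s*t³)

    representative : ∃₂ λ l u → CubeRootFq l × ¬ (u ≡ 0#) × (a , b , c) ∼ point l u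
    -- The choice is λ = ω² = 1/ω and u = a/h with h^(q-1) = s t^q. Computing a^(q²) produces t^(q²)
    -- twice, whereas h^(q²) contains t^(q²) t^q; the quotient t^(q²)/t^q = ω is what λ has to
    -- cancel.
    representative = ω * ω , a * v , (InFq-* fω fω , cubeRoot-² ω³≡1) ,
      *-≢0 a≢0 (*≡1⇒≢0 (trans (*-comm v h) hv≡1)) , h , h≢0 , cong₂ _,_ a≡ (cong₂ _,_ b≡ c≡)
      where
      hilbert = hilbert90 (s * fr t) norm-st^q
      h = proj₁ hilbert
      h≢0 = proj₁ (proj₂ hilbert)
      fh : fr h ≡ s * fr t * h
      fh = proj₂ (proj₂ hilbert)
      ffh : fr (fr h) ≡ fr s * fr (fr t) * (s * fr t * h)
      ffh = trans (cong fr fh) (trans (fr-* (s * fr t) h) (cong₂ _*_ (fr-* s (fr t)) fh))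
      v = proj₁ (inverse h h≢0)
      hv≡1 : h * v ≡ 1#
      hv≡1 = proj₂ (inverse h h≢0)
      a≡ : a ≡ h * (a * v)
      a≡ = trans (sym (*-identityʳ a)) (trans (cong (a *_) (sym hv≡1))
        (solve 3 (λ a h v → a :* (h :* v) := h :* (a :* v)) refl a h v))
      b≡ : b ≡ h * fr (a * v)
      b≡ = begin
        b                              ≡⟨ sym (*-identityʳ b) ⟩
        b * 1#                         ≡⟨ cong (b *_) (sym (fr-inverse hv≡1)) ⟩
        b * (fr h * fr v)              ≡⟨ cong (λ w → b * (w * fr v)) fh ⟩
        b * (s * fr t * h * fr v)      ≡⟨ solve 5 (λ b s t h v → b :* (s :* t :* h :* v) := h :* (s :* (t :* b) :* v)) refl b s (fr t) h (fr v) ⟩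
        h * (s * (fr t * b) * fr v)    ≡⟨ cong (λ w → h * (w * fr v)) (sym fa≡) ⟩
        h * (fr a * fr v)              ≡⟨ cong (h *_) (sym (fr-* a v)) ⟩
        h * fr (a * v)                 ∎
      c≡ : c ≡ h * (ω * ω * fr (fr (a * v)))
      c≡ = begin
        c
          ≡⟨ sym (*-identityʳ c) ⟩
        c * 1#
          ≡⟨ cong (c *_) (sym (*-identityˡ 1#)) ⟩
        c * (1# * 1#)
          ≡⟨ cong₂ (λ u w → c * (u * w)) (sym ω³≡1) (sym (fr-inverse (fr-inverse hv≡1))) ⟩
        c * (ω * ω * ω * (fr (fr h) * fr (fr v)))
          ≡⟨ cong (λ w → c * (ω * ω * ω * (w * fr (fr v)))) ffh ⟩
        c * (ω * ω * ω * (fr s * fr (fr t) * (s * fr t * h) * fr (fr v)))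
          ≡⟨ solve 8 (λ c w s′ t″ s t′ h v → c :* (w :* w :* w :* (s′ :* t″ :* (s :* t′ :* h) :* v))
               := h :* (w :* w :* (s′ :* (t″ :* (s :* (w :* t′ :* c))) :* v))) refl c ω (fr s) (fr (fr t)) s (fr t) h (fr (fr v)) ⟩
        h * (ω * ω * (fr s * (fr (fr t) * (s * (ω * fr t * c))) * fr (fr v)))
          ≡⟨ cong (λ w → h * (ω * ω * (fr s * (fr (fr t) * (s * (w * c))) * fr (fr v)))) (sym fft≡ω*ft) ⟩
        h * (ω * ω * (fr s * (fr (fr t) * (s * (fr (fr t) * c))) * fr (fr v)))
          ≡⟨ cong (λ w → h * (ω * ω * (w * fr (fr v)))) (sym ffa≡) ⟩
        h * (ω * ω * (fr (fr a) * fr (fr v)))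
          ≡⟨ cong (λ w → h * (ω * ω * w)) (sym (trans (cong fr (fr-* a v)) (fr-* (fr a) (fr v)))) ⟩
        h * (ω * ω * fr (fr (a * v))) ∎

  fixed-plane⇒π : ∀ p₀ → IsFqPlane (Orb p₀) → FixedByφ (Orb p₀) →
    Σ Carrier (λ l → CubeRootFq l × SameSet (Orb p₀) (π l))
  fixed-plane⇒π p₀@(a , b , c)
    (_ , _ , _ , _ , _ , _ , _ , (A∈ , B∈ , C∈ , _) , ¬ABC , _) fixed =
    let t , t≢0 , s , s≢0 , eq = proj₁ (fixed p₀) (orbit-self p₀)
        a≢0 = orbit-¬collinear⇒≢0 A∈ B∈ C∈ ¬ABC
        l , u , l-cube , u≢0 , p₀∼u = representative a≢0 s≢0 t≢0
          (cong proj₁ eq) (cong (proj₁ ∘ proj₂) eq) (cong (proj₂ ∘ proj₂) eq)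
    in l , l-cube , orbit-π l u≢0 p₀∼u

  -- Points and lines of Type III

  module _ (3∣q-1 : 3 ∣ q ∸ 1) {l} (l³≡1 : IsCubeRoot l) (l≢1 : ¬ (l ≡ 1#)) where

    fixpoint-0 : ∀ {x} → l * x ≡ x → x ≡ 0#
    fixpoint-0 {x} lx≡x with x ≟ 0#
    ... | yes x≡0 = x≡0
    ... | no x≢0  = contradiction (*-cancelʳ x≢0 (trans lx≡x (sym (*-identityˡ x)))) l≢1

    -- The hypothesis says (l - 1)(y - x) = 0, used in the form l (y - x) = y - x.
    swap-≡ : ∀ {x y} → x + l * y ≡ l * x + y → x ≡ y
    swap-≡ {x} {y} eq = sym (+-≡0 (fixpoint-0 (+-cancelˡ (l * x) _ _ (begin
      l * x + l * (y + - x)        ≡⟨ sym (distribˡ l x (y + - x)) ⟩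
      l * (x + (y + - x))          ≡⟨ cong (l *_) (solve 3 (λ x y n → x :+ (y :+ n) := x :+ n :+ y) refl x y (- x)) ⟩
      l * (x + - x + y)            ≡⟨ cong (λ w → l * (w + y)) (-‿inverseʳ x) ⟩
      l * (0# + y)                 ≡⟨ cong (l *_) (+-identityˡ y) ⟩
      l * y                        ≡⟨ sym (+-identityˡ _) ⟩
      0# + l * y                   ≡⟨ cong (_+ l * y) (sym (-‿inverseʳ x)) ⟩
      x + - x + l * y              ≡⟨ solve 3 (λ x n z → x :+ n :+ z := x :+ z :+ n) refl x (- x) (l * y) ⟩
      x + l * y + - x              ≡⟨ cong (_+ - x) eq ⟩
      l * x + y + - x              ≡⟨ +-assoc _ _ _ ⟩
      l * x + (y + - x)            ∎))))

    -- Multiplication by `l` permutes the three terms cyclically, so it fixes their sum.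
    l²+l+1≡0 : l * l + l + 1# ≡ 0#
    l²+l+1≡0 = fixpoint-0 (trans
      (solve 1 (λ l → l :* (l :* l :+ l :+ con 1) := l :* l :* l :+ (l :* l :+ l)) refl l)
      (trans (cong (_+ (l * l + l)) l³≡1) (+-comm 1# _)))

    -- If l = -2, then l² + l + 1 = 0 becomes 3 = 0.
    2+l≢0 : ¬ (1# + 1# + l ≡ 0#)
    2+l≢0 eq = 3≢0 3∣q-1 (begin
      1# + (1# + 1#)                          ≡⟨ sym (+-identityˡ _) ⟩
      0# + (1# + (1# + 1#))                   ≡⟨ cong (_+ (1# + (1# + 1#))) (sym (trans (cong (_* l) eq) (zeroˡ l))) ⟩
      (1# + 1# + l) * l + (1# + (1# + 1#))    ≡⟨ solve 1 (λ l → (con 1 :+ con 1 :+ l) :* l :+ (con 1 :+ (con 1 :+ con 1)) := (l :* l :+ l :+ con 1) :+ (con 1 :+ con 1 :+ l)) refl l ⟩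
      l * l + l + 1# + (1# + 1# + l)          ≡⟨ cong₂ _+_ l²+l+1≡0 eq ⟩
      0# + 0#                                 ≡⟨ +-identityʳ 0# ⟩
      0#                                      ∎)

    -- Comparing the second equation with the first and with the third gives x = z and x = y; what
    -- remains is (2 + l) x = 0.
    circulant-nonsingular : ∀ {x y z} → x + y + l * z ≡ 0# → l * x + y + z ≡ 0# → x + l * y + z ≡ 0# →
      x ≡ 0# × y ≡ 0# × z ≡ 0#
    circulant-nonsingular {x} {y} {z} e₁ e₂ e₃ = x≡0 , trans (sym x≡y) x≡0 , trans (sym x≡z) x≡0
      where
      x≡z : x ≡ z
      x≡z = swap-≡ (+-cancelˡ y _ _ (trans (solve 3 (λ x y w → y :+ (x :+ w) := x :+ y :+ w) refl x y (l * z))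
        (trans e₁ (trans (sym e₂) (solve 3 (λ w y z → w :+ y :+ z := y :+ (w :+ z)) refl (l * x) y z)))))
      x≡y : x ≡ y
      x≡y = swap-≡ (+-cancelʳ z _ _ (trans e₃ (sym e₂)))
      x≡0 : x ≡ 0#
      x≡0 = *-cancelˡ 2+l≢0 (trans
        (solve 2 (λ l x → (con 1 :+ con 1 :+ l) :* x := x :+ x :+ l :* x) refl l x)
        (trans (cong₂ (λ y z → x + y + l * z) x≡y x≡z) (trans e₁ (sym (zeroʳ _)))))

    π-typeIII : ∀ {r} → π l r → TypeIIIPoint r
    π-typeIII {r} (x , x≢0 , r∼x) (ℓ@(d , e , f) , nz , on₁ , on₂ , on₃) =
      nz (*0ʳ x≢0 (proj₁ zeros) , *0ʳ (fr-≢0 x≢0) (proj₁ (proj₂ zeros)) ,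
          *0ʳ (fr-≢0 (fr-≢0 x≢0)) (proj₂ (proj₂ zeros)))
      where
      fl : InFq l
      fl = cubeRoot-InFq 3∣q-1 l³≡1
      *0ʳ : ∀ {a x} → ¬ (x ≡ 0#) → a * x ≡ 0# → a ≡ 0#
      *0ʳ {a} {x} x≢0 ax≡0 = *-cancelʳ x≢0 (trans ax≡0 (sym (zeroˡ x)))
      swapˡ : ∀ a l x → a * (l * x) ≡ l * (a * x)
      swapˡ = solve 3 (λ a l x → a :* (l :* x) := l :* (a :* x)) refl
      zeros : d * x ≡ 0# × e * fr x ≡ 0# × f * fr (fr x) ≡ 0#
      zeros = circulant-nonsingular
        (trans (cong (d * x + e * fr x +_) (sym (swapˡ f l _)))
          (On-∼ ℓ (∼-sym r∼x) on₁))
        (trans (cong (λ w → w + e * fr x + f * fr (fr x)) (sym (swapˡ d l x)))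
          (subst (On ℓ) (φ-point x fl) (On-∼ ℓ (∼-sym (φ-∼ r∼x)) on₂)))
        (trans (cong (λ w → d * x + w + f * fr (fr x)) (sym (swapˡ e l (fr x))))
          (subst (On ℓ) (φ²-point x fl) (On-∼ ℓ (∼-sym (φ-∼ (φ-∼ r∼x))) on₃)))

  -- Coordinates of the lines of π_λ, and duality

  rearrange-difference : ∀ {m n m′ n′} → m + n′ ≡ n + m′ → m + - n ≡ m′ + - n′
  rearrange-difference {m} {n} {m′} {n′} eq = +-cancelʳ (n + n′) _ _ (begin
    m + - n + (n + n′)        ≡⟨ solve 4 (λ m k n n′ → m :+ k :+ (n :+ n′) := m :+ n′ :+ (n :+ k)) refl m (- n) n n′ ⟩
    m + n′ + (n + - n)        ≡⟨ cong₂ _+_ eq (trans (-‿inverseʳ n) (sym (-‿inverseʳ n′))) ⟩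
    n + m′ + (n′ + - n′)      ≡⟨ solve 4 (λ m′ k n n′ → n :+ m′ :+ (n′ :+ k) := m′ :+ k :+ (n :+ n′)) refl m′ (- n′) n n′ ⟩
    m′ + - n′ + (n + n′)      ∎)

  *-difference : ∀ a m n → a * (m + - n) ≡ a * m + - (a * n)
  *-difference a m n = trans (distribˡ a m (- n)) (cong (a * m +_) (sym (-‿distribʳ-* a n)))

  -- The line joining the points of x and y is (w^q, w^(q²), w/l) with w = x y^q − y x^q, by Cramer's rule.
  line-coordinates : ∀ {l} → IsCubeRoot l → ∀ ℓ → SLine (π l) ℓ → π (l * l) ℓ
  line-coordinates {l} l³≡1 ℓ@(d , e , f) ℓ-line =
    from-points (two-points l (cubeRoot-≢0 l³≡1) ℓ ℓ-line)
    where
    from-points : (∃₂ λ x y → Independent x y × On ℓ (point l x) × On ℓ (point l y)) → π (l * l) ℓ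
    from-points (x , y , (x≢0 , y∉) , on-x , on-y) =
      -- The parameter is w^q, whose conjugates are w^q, w^(q²) and w; the scalar is g/w.
      fr w , fr-≢0 w≢0 , g * i , *-≢0 g≢0 (*≡1⇒≢0 (trans (*-comm i w) wi≡1)) ,
      cong₂ _,_ (from-w dw≡) (cong₂ _,_ (from-w ew≡) f≡)
      where
      g w : Carrier
      g = f * l
      w = x * fr y + - (y * fr x)
      rx : d * x + e * fr x + g * fr (fr x) ≡ 0#
      rx = On⇒root l ℓ on-x
      ry : d * y + e * fr y + g * fr (fr y) ≡ 0#
      ry = On⇒root l ℓ on-y
      -- If w = 0, then (y/x)^q = y/x, so y is an F_q-multiple of x.
      w≢0 : ¬ (w ≡ 0#)
      w≢0 w≡0 = y∉ α fα (sym αx≡y)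
        where
        x⁻¹ = proj₁ (inverse x x≢0)
        xx⁻¹≡1 = proj₂ (inverse x x≢0)
        α = y * x⁻¹
        αx≡y : α * x ≡ y
        αx≡y = trans (solve 3 (λ y i x → y :* i :* x := y :* (x :* i)) refl y x⁻¹ x)
          (trans (cong (y *_) xx⁻¹≡1) (*-identityʳ y))
        fα : InFq α
        fα = *-cancelʳ (fr-≢0 x≢0) (*-cancelˡ x≢0 (begin
          x * (fr α * fr x)     ≡⟨ cong (x *_) (trans (sym (fr-* α x)) (cong fr αx≡y)) ⟩
          x * fr y              ≡⟨ +-≡0 w≡0 ⟩
          y * fr x              ≡⟨ cong (_* fr x) (sym αx≡y) ⟩
          α * x * fr x          ≡⟨ solve 3 (λ a x x′ → a :* x :* x′ := x :* (a :* x′)) refl α x (fr x) ⟩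
          x * (α * fr x)        ∎))
      fr-difference : ∀ a b c d → fr (a * b + - (c * d)) ≡ fr a * fr b + - (fr c * fr d)
      fr-difference a b c d = trans (fr-+ _ _) (cong₂ _+_ (fr-* a b) (trans (fr-neg _) (cong -_ (fr-* c d))))
      fw≡ : fr w ≡ fr x * fr (fr y) + - (fr y * fr (fr x))
      fw≡ = fr-difference x (fr y) y (fr x)
      ffw≡ : fr (fr w) ≡ fr (fr x) * y + - (fr (fr y) * x)
      ffw≡ = trans (cong fr fw≡) (trans (fr-difference (fr x) (fr (fr y)) (fr y) (fr (fr x)))
        (cong₂ (λ u v → fr (fr x) * u + - (fr (fr y) * v)) (fr³ y) (fr³ x)))
      *0≡*0 : ∀ {a b u v} → u ≡ 0# → v ≡ 0# → a * u ≡ b * v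
      *0≡*0 {a} {b} refl refl = trans (zeroʳ a) (sym (zeroʳ b))
      -- Multiplying the first equation by y^q and the second by x^q makes the terms in e equal, and
      -- they cancel.
      dw≡ : d * w ≡ g * fr w
      dw≡ = trans (*-difference d _ _) (trans (rearrange-difference (+-cancelʳ (e * (fr x * fr y)) _ _
        (trans (solve 8 (λ d e g x y x′ y′ x″ → d :* (x :* y′) :+ g :* (y′ :* x″) :+ e :* (x′ :* y′)
                  := y′ :* (d :* x :+ e :* x′ :+ g :* x″)) refl d e g x y (fr x) (fr y) (fr (fr x)))
        (trans (*0≡*0 rx ry)
          (solve 8 (λ d e g x y x′ y′ y″ → x′ :* (d :* y :+ e :* y′ :+ g :* y″)
                  := d :* (y :* x′) :+ g :* (x′ :* y″) :+ e :* (x′ :* y′)) refl d e g x y (fr x) (fr y) (fr (fr y)))))))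
        (trans (sym (*-difference g _ _)) (cong (g *_) (sym fw≡))))
      -- The terms in d cancel in the same way, with multipliers y and x.
      ew≡ : e * w ≡ g * fr (fr w)
      ew≡ = trans (*-difference e _ _) (trans (rearrange-difference (+-cancelʳ (d * (x * y)) _ _
        (trans (solve 8 (λ d e g x y x′ y′ y″ → e :* (x :* y′) :+ g :* (y″ :* x) :+ d :* (x :* y)
                  := x :* (d :* y :+ e :* y′ :+ g :* y″)) refl d e g x y (fr x) (fr y) (fr (fr y)))
        (trans (*0≡*0 ry rx)
          (solve 8 (λ d e g x y x′ y′ x″ → y :* (d :* x :+ e :* x′ :+ g :* x″)
                  := e :* (y :* x′) :+ g :* (x″ :* y) :+ d :* (x :* y)) refl d e g x y (fr x) (fr y) (fr (fr x)))))))
        (trans (sym (*-difference g _ _)) (cong (g *_) (sym ffw≡))))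
      i = proj₁ (inverse w w≢0)
      wi≡1 : w * i ≡ 1#
      wi≡1 = proj₂ (inverse w w≢0)
      from-w : ∀ {a b} → a * w ≡ g * b → a ≡ g * i * b
      from-w {a} {b} eq = begin
        a              ≡⟨ sym (*-identityʳ a) ⟩
        a * 1#         ≡⟨ cong (a *_) (sym wi≡1) ⟩
        a * (w * i)    ≡⟨ sym (*-assoc a w i) ⟩
        a * w * i      ≡⟨ cong (_* i) eq ⟩
        g * b * i      ≡⟨ solve 3 (λ g b i → g :* b :* i := g :* i :* b) refl g b i ⟩
        g * i * b      ∎
      f≡ : f ≡ g * i * (l * l * fr (fr (fr w)))
      f≡ = begin
        f                                      ≡⟨ solve 1 (λ f → f := f :* con 1 :* con 1) refl f ⟩
        f * 1# * 1#                            ≡⟨ sym (cong₂ (λ u v → f * u * v) l³≡1 wi≡1) ⟩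
        f * (l * l * l) * (w * i)              ≡⟨ solve 4 (λ f l w i → f :* (l :* l :* l) :* (w :* i) := f :* l :* i :* (l :* l :* w)) refl f l w i ⟩
        g * i * (l * l * w)                    ≡⟨ cong (λ u → g * i * (l * l * u)) (sym (fr³ w)) ⟩
        g * i * (l * l * fr (fr (fr w)))       ∎
      g≢0 : ¬ (g ≡ 0#)
      g≢0 g≡0 = proj₁ ℓ-line (vanish (from-w dw≡) , vanish (from-w ew≡) , vanish f≡)
        where
        vanish : ∀ {a b} → a ≡ g * i * b → a ≡ 0#
        vanish {b = b} eq = trans eq (trans (cong (_* b) (trans (cong (_* i) g≡0) (zeroˡ i))) (zeroˡ b))

  On-comm : ∀ ℓ r → On ℓ r → On r ℓ
  On-comm (a , b , c) (x , y , z) on =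
    trans (cong₂ _+_ (cong₂ _+_ (*-comm x a) (*-comm y b)) (*-comm z c)) on

  concurrent⇒collinear : ∀ {ℓ m n} → Concurrent ℓ m n → Collinear ℓ m n
  concurrent⇒collinear {ℓ} {m} {n} (r , nz , on₁ , on₂ , on₃) =
    r , nz , On-comm ℓ r on₁ , On-comm m r on₂ , On-comm n r on₃

  -- A point common to three lines is, with the roles of the coordinates exchanged, a line through
  -- the three coordinate triples. As `φL` and `φ` are the same map on triples, the case of points
  -- applies to `ℓ` as an element of π_(λ²).
  lines-typeIII : 3 ∣ q ∸ 1 → ∀ {l} → IsCubeRoot l → ¬ (l ≡ 1#) → ∀ ℓ → SLine (π l) ℓ → TypeIIILine ℓ
  lines-typeIII 3∣q-1 {l} l³≡1 l≢1 ℓ ℓ-line concurrent =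
    π-typeIII 3∣q-1 (cubeRoot-² l³≡1) l²≢1 (line-coordinates l³≡1 ℓ ℓ-line) (concurrent⇒collinear concurrent)
    where
    l²≢1 : ¬ (l * l ≡ 1#)
    l²≢1 l²≡1 = l≢1 (trans (sym (*-identityˡ l)) (trans (cong (_* l) (sym l²≡1)) l³≡1))

theorem3p2 : (q p k : ℕ) → Prime p → k ≥ 1 → q ≡ p ^ k →
    (F : FiniteField) → FiniteField.card F ≡ q ^ 3 →
    let open FiniteField F
        open PG F q
    in
    -- an S_T-orbit is an F_q-plane fixed setwise by φ iff it is some π_λ, λ ∈ F_q, λ^3 = 1
    ((p₀ : Tri) → NZ p₀ →
      ((IsFqPlane (Orb p₀) × FixedByφ (Orb p₀)) → Σ Carrier (λ l → CubeRootFq l × SameSet (Orb p₀) (π l)))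
      × (Σ Carrier (λ l → CubeRootFq l × SameSet (Orb p₀) (π l)) → IsFqPlane (Orb p₀) × FixedByφ (Orb p₀)))
    -- each such π_λ is an S_T-orbit
    × ((l : Carrier) → CubeRootFq l → Σ Tri (λ p₀ → NZ p₀ × SameSet (Orb p₀) (π l)))
    -- there are exactly gcd(3, q-1) of them, and they are pairwise distinct
    × Σ (List Carrier) (λ ls → Unique ls × length ls ≡ gcd 3 (q ∸ 1)
        × All CubeRootFq ls × ((l : Carrier) → CubeRootFq l → l ∈ ls))
    × ((l m : Carrier) → CubeRootFq l → CubeRootFq m → ¬ (l ≡ m) → ¬ SameSet (π l) (π m))
    -- π_1 = P_{2,q}
    × SameSet (π 1#) P2q
    -- if gcd(3,q-1) = 3, the other two have only Type III points and lines
    × (gcd 3 (q ∸ 1) ≡ 3 → (l : Carrier) → CubeRootFq l → ¬ (l ≡ 1#) →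
        ((r : Tri) → π l r → TypeIIIPoint r)
        × ((ℓ : Tri) → SLine (π l) ℓ → TypeIIILine ℓ))
theorem3p2 q p k pp k≥1 q≡p^k F card≡q³ =
  (λ p₀ _ →
    (λ (plane , fixed) → fixed-plane⇒π p₀ plane fixed) ,
    (λ (l , l-cube , same) →
      IsFqPlane-resp (SameSet-sym same) (π-isFqPlane l (cubeRoot-≢0 (proj₂ l-cube))) ,
      FixedByφ-resp (SameSet-sym same) (π-fixed l-cube))) ,
  (λ l _ → point l 1# , point-NZ l 1≢0 , orbit-π l 1≢0 (∼-refl _)) ,
  cubeRoots ,
  (λ l m _ _ l≢m same → l≢m (π-injective same)) ,
  π₁≡P2q ,
  (λ gcd≡3 l (_ , l³≡1) l≢1 →
    let 3∣q-1 = subst (_∣ q ∸ 1) gcd≡3 (gcd[m,n]∣n 3 (q ∸ 1)) in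
    (λ r → π-typeIII 3∣q-1 l³≡1 l≢1) , lines-typeIII 3∣q-1 l³≡1 l≢1)
  where
  open FiniteField F
  open PG F q
  open Field F q
  open CubicExtension F q p k pp k≥1 q≡p^k card≡q³
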